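{- Let $p$ be an odd prime. If $p>3$, then $$\sum_{k=1}^{p-1}\frac{\binom{2k}{k}}{4^k}H_k\equiv 2-2p+4p^2q_p(2)\pmod{p^3}.$$ Moreover (for every odd prime $p$), $$\sum_{k=0}^{(p-1)/2}\frac{\binom{2k}{k}}{4^k}H_k^{(2)}\equiv -4q_p(2)\pmod p$$ and $$\sum_{k=1}^{(p-1)/2}\frac{\binom{2k}{k}}{k4^k}H_k^{(2)}\equiv\frac{B_{p-3}}{2}\pmod p.$$
   Context: For $n=0,1,2,\ldots$, $H_n:=\sum_{0<k\leqslant n}\frac1k$ and $H_n^{(2)}:=\sum_{0<k\leqslant n}\frac{1}{k^2}$. For an odd prime $p$, $q_p(2):=(2^{p-1}-1)/p$ is the Fermat quotient. $B_0,B_1,B_2,\ldots$ are the Bernoulli numbers ($B_0=1$, $\sum_{k=0}^{n}\binom{n+1}{k}B_k=0$ for $n\geqslant1$). Congruences modulo a power $p^a$ between rational numbers are understood in the ring of rational numbers whose denominators are not divisible by $p$. -}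

module Defs where

open import Algebra.Bundles using (CommutativeRing)
open import Data.Fin.Base using (Fin; toℕ; fromℕ; inject₁)
open import Data.Fin.Properties using (toℕ<n; toℕ-fromℕ; toℕ-inject₁)
open import Data.Integer.Base as ℤ using ()
open import Data.Nat.Base as ℕ using (ℕ; zero; suc; NonZero)
open import Data.Nat.Combinatorics using (_C_; nCk≡nC[n∸k]; nC1≡n)
open import Data.Nat.Divisibility using (_∣_)
open import Data.Nat.Induction using (<-rec; <-wellFounded)
import Data.Nat.Properties as ℕₚ
open import Data.Integer.Solver using (module +-*-Solver)
open import Data.Product.Base using (_×_; ∃-syntax)
open import Data.Rational.Base
  using (ℚ; 0ℚ; 1ℚ; ↧ₙ_; _/_; _+_; _*_; _-_; -_)
open import Data.Rational.Unnormalised.Base using (mkℚᵘ; *≡*)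
import Data.Rational.Unnormalised.Properties as ℚᵘₚ
open import Data.Rational.Properties as ℚₚ using (+-*-commutativeRing)
open import Function.Base using (it)
open import Induction.WellFounded using (module FixPoint; WfRec)
open import Relation.Binary.PropositionalEquality
open import Relation.Nullary.Negation.Core using (¬_)
open import Algebra.Properties.Semiring.Sum
  (CommutativeRing.semiring +-*-commutativeRing)
  using (sum; sum-syntax; sum⁺-syntax; sum-cong-≗; sum-init-last)

fromNat : ℕ → ℚ
fromNat n = ℤ.+ n / 1

-- In ∑[1≤ k ≤ n ] the summand may divide by k: its non-zeroness is
-- available there as an instance.
∑₁ : ℕ → ((k : ℕ) → .{{NonZero k}} → ℚ) → ℚ
∑₁ n f = ∑[ i < n ] f (suc (toℕ i))

∑₀ : ℕ → (ℕ → ℚ) → ℚ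
∑₀ n f = ∑[ i ≤ n ] f (toℕ i)

infixr 6.5 ∑₁ ∑₀
syntax ∑₁ n (λ k → x) = ∑[1≤ k ≤ n ] x
syntax ∑₀ n (λ k → x) = ∑[0≤ k ≤ n ] x

centralBinom/4^ : ℕ → ℚ
centralBinom/4^ k = (ℤ.+ ((2 ℕ.* k) C k) / (4 ℕ.^ k)) {{ℕₚ.m^n≢0 4 k}}

centralBinom/k4^ : (k : ℕ) → .{{NonZero k}} → ℚ
centralBinom/k4^ k = (ℤ.+ ((2 ℕ.* k) C k) / (k ℕ.* 4 ℕ.^ k))
  {{ℕₚ.m*n≢0 k (4 ℕ.^ k) {{it}} {{ℕₚ.m^n≢0 4 k}}}}

H_⟨_⟩ : ℕ → ℕ → ℚ
H n ⟨ r ⟩ = ∑[1≤ k ≤ n ] (ℤ.1ℤ / (k ℕ.^ r)) {{ℕₚ.m^n≢0 k r}}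

fermatQuotient : (p a : ℕ) → .{{NonZero p}} → ℚ
fermatQuotient p a = (ℤ.+ (a ℕ.^ (p ℕ.∸ 1)) ℤ.- ℤ.1ℤ) / p

-- Membership in the ring of rationals with denominator not divisible by p
-- (↧ₙ is the denominator in lowest terms).
Integral : ℕ → ℚ → Set
Integral p x = ¬ (p ∣ ↧ₙ x)

-- Congruence modulo p ^ a in that ring; both sides are required to lie in it.
infix 4 _≡_[mod_^_]

_≡_[mod_^_] : ℚ → ℚ → ℕ → ℕ → Set
x ≡ y [mod p ^ a ] =
  Integral p x × Integral p y ×
  ∃[ c ] (Integral p c × x - y ≡ fromNat (p ℕ.^ a) * c)

-- The Bernoulli recurrence ∑_{k≤n+1} (n+2 choose k) B_k = 0 solved for
-- B_{n+1}, whose coefficient is n+2.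
bernoulliStep : ∀ n → WfRec ℕ._<_ (λ _ → ℚ) n → ℚ
bernoulliStep zero    _ = 1ℚ
bernoulliStep (suc n) B =
  - ((ℤ.1ℤ / suc (suc n)) *
     (∑[ i ≤ n ] (fromNat (suc (suc n) C toℕ i) * B (toℕ<n i))))

bernoulli : ℕ → ℚ
bernoulli = <-rec (λ _ → ℚ) bernoulliStep

private
  step-ext : ∀ n {B B′ : WfRec ℕ._<_ (λ _ → ℚ) n} →
             (∀ {m} m<n → B {m} m<n ≡ B′ m<n) →
             bernoulliStep n B ≡ bernoulliStep n B′
  step-ext zero    _  = refl
  step-ext (suc n) eq = cong (λ s → - ((ℤ.1ℤ / suc (suc n)) * s))
    (sum-cong-≗ λ i → cong (fromNat (suc (suc n) C toℕ i) *_) (eq (toℕ<n i)))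

  unfold : ∀ n → bernoulli n ≡ bernoulliStep n (λ {m} _ → bernoulli m)
  unfold n =
    FixPoint.unfold-wfRec <-wellFounded (λ _ → ℚ) bernoulliStep step-ext {n}

  cancel : ∀ n s → fromNat (suc n) * - ((ℤ.1ℤ / suc n) * s) ≡ - s
  cancel n s = begin
    a * - (b * s)   ≡⟨ ℚₚ.neg-distribʳ-* a (b * s) ⟨
    - (a * (b * s)) ≡⟨ cong -_ (ℚₚ.*-assoc a b s) ⟨
    - (a * b * s)   ≡⟨ cong (λ t → - (t * s)) a*b≡1 ⟩
    - (1ℚ * s)      ≡⟨ cong -_ (ℚₚ.*-identityˡ s) ⟩
    - s             ∎
    where
    open ≡-Reasoning
    open +-*-Solver using (solve; _:*_; _:=_; con)
    a = fromNat (suc n)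
    b = ℤ.1ℤ / suc n
    a*b≡1 : a * b ≡ 1ℚ
    a*b≡1 = ℚₚ.toℚᵘ-injective (ℚᵘₚ.≃-trans (ℚₚ.toℚᵘ-homo-* a b)
      (ℚᵘₚ.≃-trans
        (ℚᵘₚ.*-cong (ℚₚ.toℚᵘ-fromℚᵘ (mkℚᵘ (ℤ.+ suc n) 0))
                    (ℚₚ.toℚᵘ-fromℚᵘ (mkℚᵘ ℤ.1ℤ n)))
        (*≡* (solve 1 (λ x → (x :* con ℤ.1ℤ) :* con ℤ.1ℤ := con ℤ.1ℤ :* (con ℤ.1ℤ :* x)) refl (ℤ.+ suc n)))))

bernoulli-zero : bernoulli 0 ≡ 1ℚ
bernoulli-zero = refl

bernoulli-recurrence : ∀ n →
  ∑[0≤ k ≤ suc n ] fromNat ((suc n ℕ.+ 1) C k) * bernoulli k ≡ 0ℚ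
bernoulli-recurrence n rewrite ℕₚ.+-comm n 1 = begin
  sum t                    ≡⟨ sum-init-last t ⟩
  sum (λ i → t (inject₁ i)) + t (fromℕ (suc n))
    ≡⟨ cong₂ _+_ (sum-cong-≗ {suc n} λ i → cong term (toℕ-inject₁ i)) (cong term (toℕ-fromℕ (suc n))) ⟩
  s + term (suc n)         ≡⟨ cong (λ z → s + z * bernoulli (suc n)) (cong fromNat coeff) ⟩
  s + fromNat (suc (suc n)) * bernoulli (suc n)
    ≡⟨ cong (λ z → s + fromNat (suc (suc n)) * z) (unfold (suc n)) ⟩
  s + fromNat (suc (suc n)) * - ((ℤ.1ℤ / suc (suc n)) * s)
    ≡⟨ cong (s +_) (cancel (suc n) s) ⟩
  s + - s                  ≡⟨ ℚₚ.+-inverseʳ s ⟩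
  0ℚ                       ∎
  where
  open ≡-Reasoning
  term : ℕ → ℚ
  term k = fromNat (suc (suc n) C k) * bernoulli k
  t : Fin (suc (suc n)) → ℚ
  t i = term (toℕ i)
  s : ℚ
  s = ∑[ i ≤ n ] term (toℕ i)
  coeff : suc (suc n) C suc n ≡ suc (suc n)
  coeff = trans (nCk≡nC[n∸k] (ℕₚ.n≤1+n (suc n)))
    (trans (cong (suc (suc n) C_) (ℕₚ.m+n∸n≡m 1 (suc n))) (nC1≡n (suc (suc n))))

{-# OPTIONS --safe #-}
module Submission where

open import Defs
open import Algebra.Bundles using (CommutativeRing)
open import Data.Rational.Properties as ℚₚ using (+-*-commutativeRing)
open import Algebra.Properties.Semiring.Sum
  (CommutativeRing.semiring +-*-commutativeRing)
  using (sum; sum-cong-≗; sum-init-last; ∑-distrib-+; *-distribˡ-sum)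
open import Data.Fin.Base using (toℕ)
open import Data.Fin.Properties using (toℕ-fromℕ; toℕ-inject₁; toℕ<n)
open import Data.Integer.Base as ℤ using (ℤ)
import Data.Integer.Properties as ℤₚ
open import Data.Integer.Solver using () renaming (module +-*-Solver to ℤ-Solver)
open import Data.Nat.Base as ℕ using (ℕ; zero; suc; _<_; _≤_; _∸_; NonZero; z≤n; s≤s)
open import Data.Nat.Combinatorics using (_C_; nCk+nC[k+1]≡[n+1]C[k+1]; nC1≡n; nCn≡1; k>n⇒nCk≡0)
open import Data.Nat.Coprimality as Coprimality using (coprime-divisor)
open import Data.Nat.DivMod using (m*n/n≡m)
open import Data.Nat.Divisibility using (_∣_; divides; ∣-trans; ∣-refl; _∣0; ∣m∣n⇒∣m+n; >⇒∤; ∣1⇒≡1)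
open import Data.Nat.Primality using (Prime; prime⇒nonZero; euclidsLemma; ¬prime[1])
import Data.Nat.Properties as ℕₚ
open import Data.Nat.Solver using () renaming (module +-*-Solver to ℕ-Solver)
open import Data.Product.Base using (_×_; _,_; ∃-syntax)
open import Data.Rational.Base
  using (ℚ; mkℚ; 0ℚ; 1ℚ; ½; ↥_; ↧ₙ_; toℚᵘ; _/_; _+_; _*_; _-_; -_)
open import Data.Rational.Solver using (module +-*-Solver)
open import Data.Rational.Unnormalised.Base as ℚᵘ using (mkℚᵘ; *≡*)
import Data.Rational.Unnormalised.Properties as ℚᵘₚ
open import Data.Sum.Base using ([_,_]′; inj₁; inj₂)
open import Function.Base using (_∘_; it)
open import Relation.Binary.PropositionalEquality
open import Relation.Nullary.Negation.Core using (¬_; contradiction)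

-- Write p = 2n+1, N = p-1, e = p-3, a_k = C(2k,k)/4^k.
--
-- (1) Since ∑_{k≤n} a_k = (2n+1) a_n, summation by parts gives exactly
-- ∑_{k≤n} a_k H_k = (2n+1) a_n (H_n - 2) + 2; at n = N the leading factor is
-- p C(2p-1,N) / 4^N with C(2p-1,N) ≡ 1 + p H_N (mod p²), and p² ∣ H_N.
--
-- (2) Likewise ∑ a_k H_k^(2) ≡ -2 ∑ a_k/k. Modulo p, a_k ≡ (-1)^k C(n,k), which
-- turns the sum into an n-th finite difference, equal to -H_n; expanding
-- 2^p = (1+1)^p gives H_n ≡ -2 q_p(2).
--
-- (3) The finite difference is now -A with A = ∑_{k≤n} H_k/k². Put
-- W = ∑_{k≤N} H_k/k². Reflecting k ↦ p-k gives W ≡ 2A - H_n^(3). As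
-- (-1)^k C(N,k) ≡ 1 - p H_k (mod p²) and the N-th difference of k^e vanishes,
-- p W ≡ ∑_{k<p} k^e ≡ p B_e (mod p²). Evaluating ∑_{k<p} k^e modulo p² once by
-- k ↦ p-k and once by splitting into even and odd k gives H_n^(3) ≡ -2 B_e.

open +-*-Solver using (solve; _:+_; _:*_; _:-_; :-_; _:=_; con)
open ≡-Reasoning

-- The obstacle in (3) is that power sums determine only p B_e, so whatever leads to B_e has to be
-- known modulo p² before a factor p can be cancelled. The link is that the sums of k^j over k < p
-- and the numbers p B_j solve the same triangular system with rows C(m+1, j), j ≤ m: the right-hand
-- sides agree in the first row and differ by p^(m+1), a multiple of p², in the others. For j ≤ p-2
-- the diagonal entries are units, which also makes B_j integral. In (1) the Fermat quotient enters
-- through the denominator, 4^N = (1 + p q)². The prime 3 is exceptional throughout: H_2 = 3/2 is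
-- not divisible by 9, the term 0^e of the power sum is 1 for e = 0, and the elimination that yields
-- H_n^(3) divides by 3. In (3) that prime is settled by direct evaluation.

2ℚ 3ℚ 4ℚ : ℚ
2ℚ = fromNat 2
3ℚ = fromNat 3
4ℚ = fromNat 4

-- Opaque, so that no rational is ever normalised. Note the shift r k = 1/(k+1).
opaque
  ι : ℕ → ℚ
  ι = fromNat

  r : ℕ → ℚ
  r k = ℤ.1ℤ / suc k

  fromNat≡ι : ∀ n → fromNat n ≡ ι n
  fromNat≡ι n = refl

  1/suc≡r : ∀ k → ℤ.1ℤ / suc k ≡ r k
  1/suc≡r k = refl

-- Fractions

-- Reduction to lowest terms is invisible up to `≃`, so identities between fractions are proved by
-- cross-multiplication on the unnormalised side.
toℚᵘ-/ : ∀ z d .{{_ : NonZero d}} → toℚᵘ (z / d) ℚᵘ.≃ (z ℚᵘ./ d)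
toℚᵘ-/ z (suc d) = ℚₚ.toℚᵘ-fromℚᵘ (mkℚᵘ z d)

/1-+ : ∀ x y → (x ℤ.+ y) / 1 ≡ x / 1 + y / 1
/1-+ x y = ℚₚ.toℚᵘ-injective (ℚᵘₚ.≃-trans (toℚᵘ-/ (x ℤ.+ y) 1) (ℚᵘₚ.≃-sym
  (ℚᵘₚ.≃-trans (ℚₚ.toℚᵘ-homo-+ (x / 1) (y / 1))
  (ℚᵘₚ.≃-trans (ℚᵘₚ.+-cong (toℚᵘ-/ x 1) (toℚᵘ-/ y 1))
    (*≡* (ℤ-Solver.solve 2 (λ x y → (x ℤ-Solver.:* ℤ-Solver.con ℤ.1ℤ ℤ-Solver.:+ y ℤ-Solver.:* ℤ-Solver.con ℤ.1ℤ) ℤ-Solver.:* ℤ-Solver.con ℤ.1ℤ ℤ-Solver.:= (x ℤ-Solver.:+ y) ℤ-Solver.:* (ℤ-Solver.con ℤ.1ℤ ℤ-Solver.:* ℤ-Solver.con ℤ.1ℤ)) refl x y))))))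

/1-* : ∀ x y → (x ℤ.* y) / 1 ≡ (x / 1) * (y / 1)
/1-* x y = ℚₚ.toℚᵘ-injective (ℚᵘₚ.≃-trans (toℚᵘ-/ (x ℤ.* y) 1) (ℚᵘₚ.≃-sym
  (ℚᵘₚ.≃-trans (ℚₚ.toℚᵘ-homo-* (x / 1) (y / 1))
               (ℚᵘₚ.*-cong (toℚᵘ-/ x 1) (toℚᵘ-/ y 1)))))

opaque
  unfolding ι r

  ι-+ : ∀ m n → ι (m ℕ.+ n) ≡ ι m + ι n
  ι-+ m n = /1-+ (ℤ.+ m) (ℤ.+ n)

ι-suc : ∀ n → ι (suc n) ≡ 1ℚ + ι n
ι-suc n = trans (ι-+ 1 n) (cong (_+ ι n) (sym (fromNat≡ι 1)))

opaque
  unfolding ι r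

  ι-* : ∀ m n → ι (m ℕ.* n) ≡ ι m * ι n
  ι-* m n = trans (cong (_/ 1) (ℤₚ.pos-* m n)) (/1-* (ℤ.+ m) (ℤ.+ n))

ι-double : ∀ n → ι (n ℕ.+ n) ≡ 2ℚ * ι n
ι-double n = trans (ι-+ n n) (solve 1 (λ x → x :+ x := con 2ℚ :* x) refl (ι n))

opaque
  unfolding ι r

  ι*/ : ∀ z d .{{_ : NonZero d}} → ι d * (z / d) ≡ z / 1
  ι*/ z (suc d) = ℚₚ.toℚᵘ-injective (ℚᵘₚ.≃-trans (ℚₚ.toℚᵘ-homo-* (ι (suc d)) (z / suc d))
    (ℚᵘₚ.≃-trans (ℚᵘₚ.*-cong (toℚᵘ-/ (ℤ.+ suc d) 1) (toℚᵘ-/ z (suc d)))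
    (ℚᵘₚ.≃-trans
      (*≡* (ℤ-Solver.solve 2 (λ d z → (d ℤ-Solver.:* z) ℤ-Solver.:* ℤ-Solver.con ℤ.1ℤ ℤ-Solver.:= z ℤ-Solver.:* (ℤ-Solver.con ℤ.1ℤ ℤ-Solver.:* d)) refl (ℤ.+ suc d) z))
      (ℚᵘₚ.≃-sym (toℚᵘ-/ z 1)))))

ι*r : ∀ k → ι (suc k) * r k ≡ 1ℚ
ι*r k = trans (cong (ι (suc k) *_) (sym (1/suc≡r k))) (ι*/ ℤ.1ℤ (suc k))

ι-cancelˡ : ∀ d .{{_ : NonZero d}} {x y} → ι d * x ≡ ι d * y → x ≡ y
ι-cancelˡ (suc d) {x} {y} eq = trans (sym (unit x)) (trans (cong (r d *_) eq) (unit y))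
  where
  unit : ∀ z → r d * (ι (suc d) * z) ≡ z
  unit z = begin
    r d * (ι (suc d) * z) ≡⟨ solve 3 (λ r d z → r :* (d :* z) := (d :* r) :* z) refl (r d) (ι (suc d)) z ⟩
    ι (suc d) * r d * z   ≡⟨ cong (_* z) (ι*r d) ⟩
    1ℚ * z                ≡⟨ ℚₚ.*-identityˡ z ⟩
    z                     ∎

-- Multiplying by the denominator identifies a quotient; the fractions of the statement are matched
-- with products of `r` in this way.
/-unique : ∀ z d .{{_ : NonZero d}} {x} → ι d * x ≡ z / 1 → x ≡ z / d
/-unique z d eq = ι-cancelˡ d (trans eq (sym (ι*/ z d)))

ι-^-* : ∀ x y n → ι ((x ℕ.* y) ℕ.^ n) ≡ ι (x ℕ.^ n) * ι (y ℕ.^ n)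
ι-^-* x y zero    = trans (sym (fromNat≡ι 1)) (cong₂ _*_ (fromNat≡ι 1) (fromNat≡ι 1))
ι-^-* x y (suc n) = begin
  ι (x ℕ.* y ℕ.* (x ℕ.* y) ℕ.^ n)
    ≡⟨ trans (ι-* (x ℕ.* y) _) (cong₂ _*_ (ι-* x y) (ι-^-* x y n)) ⟩
  ι x * ι y * (ι (x ℕ.^ n) * ι (y ℕ.^ n))
    ≡⟨ solve 4 (λ x y u v → x :* y :* (u :* v) := x :* u :* (y :* v)) refl (ι x) (ι y) (ι (x ℕ.^ n)) (ι (y ℕ.^ n)) ⟩
  ι x * ι (x ℕ.^ n) * (ι y * ι (y ℕ.^ n))
    ≡⟨ cong₂ _*_ (ι-* x (x ℕ.^ n)) (ι-* y (y ℕ.^ n)) ⟨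
  ι (x ℕ.^ suc n) * ι (y ℕ.^ suc n) ∎

-- Sums

opaque
  Σ< : ℕ → (ℕ → ℚ) → ℚ
  Σ< n f = sum {n} (f ∘ toℕ)

  Σ-cong< : ∀ n {f g} → (∀ k → k < n → f k ≡ g k) → Σ< n f ≡ Σ< n g
  Σ-cong< n eq = sum-cong-≗ {n} λ i → eq (toℕ i) (toℕ<n i)

  Σ-zero : ∀ f → Σ< 0 f ≡ 0ℚ
  Σ-zero f = refl

  Σ-head : ∀ n f → Σ< (suc n) f ≡ f 0 + Σ< n (f ∘ suc)
  Σ-head n f = refl

  Σ-last : ∀ n f → Σ< (suc n) f ≡ Σ< n f + f n
  Σ-last n f = trans (sum-init-last {n} (f ∘ toℕ))
    (cong₂ _+_ (sum-cong-≗ {n} λ i → cong f (toℕ-inject₁ i)) (cong f (toℕ-fromℕ n)))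

  Σ-+ : ∀ n f g → Σ< n (λ k → f k + g k) ≡ Σ< n f + Σ< n g
  Σ-+ n f g = ∑-distrib-+ {n} (f ∘ toℕ) (g ∘ toℕ)

  Σ-*ˡ : ∀ n c f → Σ< n (λ k → c * f k) ≡ c * Σ< n f
  Σ-*ˡ n c f = sym (*-distribˡ-sum {n} c (f ∘ toℕ))

Σ-cong : ∀ n {f g} → (∀ k → f k ≡ g k) → Σ< n f ≡ Σ< n g
Σ-cong n eq = Σ-cong< n λ k _ → eq k

Σ-- : ∀ n f g → Σ< n (λ k → f k - g k) ≡ Σ< n f - Σ< n g
Σ-- n f g = begin
  Σ< n (λ k → f k - g k)             ≡⟨ Σ-cong n (λ k → solve 2 (λ x y → x :- y := x :+ con (- 1ℚ) :* y) refl (f k) (g k)) ⟩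
  Σ< n (λ k → f k + (- 1ℚ) * g k)    ≡⟨ Σ-+ n f _ ⟩
  Σ< n f + Σ< n (λ k → (- 1ℚ) * g k) ≡⟨ cong (Σ< n f +_) (Σ-*ˡ n (- 1ℚ) g) ⟩
  Σ< n f + (- 1ℚ) * Σ< n g           ≡⟨ solve 2 (λ x y → x :+ con (- 1ℚ) :* y := x :- y) refl (Σ< n f) (Σ< n g) ⟩
  Σ< n f - Σ< n g                    ∎

Σ-reverse : ∀ n f → Σ< n f ≡ Σ< n (λ k → f (n ∸ suc k))
Σ-reverse zero    f = trans (Σ-zero f) (sym (Σ-zero _))
Σ-reverse (suc n) f = begin
  Σ< (suc n) f                       ≡⟨ Σ-last n f ⟩
  Σ< n f + f n                       ≡⟨ ℚₚ.+-comm (Σ< n f) (f n) ⟩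
  f n + Σ< n f                       ≡⟨ cong (f n +_) (Σ-reverse n f) ⟩
  f n + Σ< n (λ k → f (n ∸ suc k))   ≡⟨ Σ-head n _ ⟨
  Σ< (suc n) (λ k → f (suc n ∸ suc k)) ∎

Σ-append : ∀ m n f → Σ< (m ℕ.+ n) f ≡ Σ< m f + Σ< n (λ k → f (m ℕ.+ k))
Σ-append zero    n f = sym (trans (cong (_+ Σ< n f) (Σ-zero f)) (ℚₚ.+-identityˡ _))
Σ-append (suc m) n f = begin
  Σ< (suc (m ℕ.+ n)) f                                    ≡⟨ Σ-head (m ℕ.+ n) f ⟩
  f 0 + Σ< (m ℕ.+ n) (f ∘ suc)                            ≡⟨ cong (f 0 +_) (Σ-append m n (f ∘ suc)) ⟩
  f 0 + (Σ< m (f ∘ suc) + Σ< n (λ k → f (suc m ℕ.+ k)))   ≡⟨ ℚₚ.+-assoc (f 0) _ _ ⟨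
  f 0 + Σ< m (f ∘ suc) + Σ< n (λ k → f (suc m ℕ.+ k))     ≡⟨ cong (_+ Σ< n (λ k → f (suc m ℕ.+ k))) (Σ-head m f) ⟨
  Σ< (suc m) f + Σ< n (λ k → f (suc m ℕ.+ k))             ∎

-- Index `k` usually stands for the integer k + 1, so for n + n = p - 1 this pairs x with p - x.
Σ-fold : ∀ n f → Σ< (n ℕ.+ n) f ≡ Σ< n (λ k → f k + f (n ℕ.+ n ∸ suc k))
Σ-fold n f = begin
  Σ< (n ℕ.+ n) f                               ≡⟨ Σ-append n n f ⟩
  Σ< n f + Σ< n (λ k → f (n ℕ.+ k))            ≡⟨ cong (Σ< n f +_) (Σ-reverse n _) ⟩
  Σ< n f + Σ< n (λ k → f (n ℕ.+ (n ∸ suc k)))  ≡⟨ cong (Σ< n f +_) (Σ-cong< n λ k k<n → cong f (sym (ℕₚ.+-∸-assoc n k<n))) ⟩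
  Σ< n f + Σ< n (λ k → f (n ℕ.+ n ∸ suc k))    ≡⟨ Σ-+ n f _ ⟨
  Σ< n (λ k → f k + f (n ℕ.+ n ∸ suc k))       ∎

Σ-parity : ∀ n f → Σ< (n ℕ.+ n) f ≡ Σ< n (λ k → f (k ℕ.+ k) + f (suc (k ℕ.+ k)))
Σ-parity zero    f = trans (Σ-zero f) (sym (Σ-zero _))
Σ-parity (suc n) f = begin
  Σ< (suc n ℕ.+ suc n) f                         ≡⟨ cong (λ m → Σ< (suc m) f) (ℕₚ.+-suc n n) ⟩
  Σ< (suc (suc (n ℕ.+ n))) f                     ≡⟨ Σ-last (suc (n ℕ.+ n)) f ⟩
  Σ< (suc (n ℕ.+ n)) f + f (suc (n ℕ.+ n))       ≡⟨ cong (_+ f (suc (n ℕ.+ n))) (Σ-last (n ℕ.+ n) f) ⟩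
  Σ< (n ℕ.+ n) f + f (n ℕ.+ n) + f (suc (n ℕ.+ n))
    ≡⟨ ℚₚ.+-assoc (Σ< (n ℕ.+ n) f) _ _ ⟩
  Σ< (n ℕ.+ n) f + (f (n ℕ.+ n) + f (suc (n ℕ.+ n)))
    ≡⟨ cong (_+ (f (n ℕ.+ n) + f (suc (n ℕ.+ n)))) (Σ-parity n f) ⟩
  Σ< n (λ k → f (k ℕ.+ k) + f (suc (k ℕ.+ k))) + (f (n ℕ.+ n) + f (suc (n ℕ.+ n)))
    ≡⟨ Σ-last n _ ⟨
  Σ< (suc n) (λ k → f (k ℕ.+ k) + f (suc (k ℕ.+ k))) ∎

-- Binomial transforms

absorption : ∀ n k → suc k ℕ.* (suc n C suc k) ≡ suc n ℕ.* (n C k)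
absorption n zero = begin
  1 ℕ.* (suc n C 1) ≡⟨ ℕₚ.*-identityˡ _ ⟩
  suc n C 1         ≡⟨ nC1≡n (suc n) ⟩
  suc n             ≡⟨ ℕₚ.*-identityʳ (suc n) ⟨
  suc n ℕ.* 1       ∎
absorption zero (suc k) = begin
  suc (suc k) ℕ.* (1 C suc (suc k)) ≡⟨ cong (suc (suc k) ℕ.*_) (k>n⇒nCk≡0 {1} {suc (suc k)} (s≤s (s≤s z≤n))) ⟩
  suc (suc k) ℕ.* 0                 ≡⟨ ℕₚ.*-zeroʳ (suc (suc k)) ⟩
  0                                 ∎
absorption (suc n) (suc k) = begin
  suc (suc k) ℕ.* (suc (suc n) C suc (suc k))
    ≡⟨ cong (suc (suc k) ℕ.*_) (nCk+nC[k+1]≡[n+1]C[k+1] (suc n) (suc k)) ⟨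
  suc (suc k) ℕ.* ((suc n C suc k) ℕ.+ (suc n C suc (suc k)))
    ≡⟨ ℕₚ.*-distribˡ-+ (suc (suc k)) (suc n C suc k) _ ⟩
  ((suc n C suc k) ℕ.+ suc k ℕ.* (suc n C suc k)) ℕ.+ suc (suc k) ℕ.* (suc n C suc (suc k))
    ≡⟨ cong₂ (λ x y → ((suc n C suc k) ℕ.+ x) ℕ.+ y) (absorption n k) (absorption n (suc k)) ⟩
  ((suc n C suc k) ℕ.+ suc n ℕ.* (n C k)) ℕ.+ suc n ℕ.* (n C suc k)
    ≡⟨ ℕₚ.+-assoc (suc n C suc k) _ _ ⟩
  (suc n C suc k) ℕ.+ (suc n ℕ.* (n C k) ℕ.+ suc n ℕ.* (n C suc k))
    ≡⟨ cong ((suc n C suc k) ℕ.+_) (ℕₚ.*-distribˡ-+ (suc n) (n C k) _) ⟨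
  (suc n C suc k) ℕ.+ suc n ℕ.* ((n C k) ℕ.+ (n C suc k))
    ≡⟨ cong (λ x → (suc n C suc k) ℕ.+ suc n ℕ.* x) (nCk+nC[k+1]≡[n+1]C[k+1] n k) ⟩
  suc (suc n) ℕ.* (suc n C suc k) ∎

opaque
  c : ℕ → ℕ → ℚ
  c n k = ι (n C k)

  c≡ι : ∀ n k → c n k ≡ ι (n C k)
  c≡ι n k = refl

c-zero : ∀ n → c n 0 ≡ 1ℚ
c-zero n = trans (c≡ι n 0) (sym (fromNat≡ι 1))

c-diag : ∀ n → c n n ≡ 1ℚ
c-diag n = trans (c≡ι n n) (trans (cong ι (nCn≡1 n)) (sym (fromNat≡ι 1)))

c-above : ∀ n → c n (suc n) ≡ 0ℚ
c-above n = trans (c≡ι n (suc n)) (trans (cong ι (k>n⇒nCk≡0 (ℕₚ.n<1+n n))) (sym (fromNat≡ι 0)))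

c-pascal : ∀ n k → c (suc n) (suc k) ≡ c n k + c n (suc k)
c-pascal n k = begin
  c (suc n) (suc k)               ≡⟨ c≡ι (suc n) (suc k) ⟩
  ι (suc n C suc k)               ≡⟨ cong ι (nCk+nC[k+1]≡[n+1]C[k+1] n k) ⟨
  ι ((n C k) ℕ.+ (n C suc k))     ≡⟨ ι-+ (n C k) (n C suc k) ⟩
  ι (n C k) + ι (n C suc k)       ≡⟨ cong₂ _+_ (c≡ι n k) (c≡ι n (suc k)) ⟨
  c n k + c n (suc k)             ∎

c-absorption : ∀ n k → ι (suc k) * c (suc n) (suc k) ≡ ι (suc n) * c n k
c-absorption n k = begin
  ι (suc k) * c (suc n) (suc k)   ≡⟨ cong (ι (suc k) *_) (c≡ι (suc n) (suc k)) ⟩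
  ι (suc k) * ι (suc n C suc k)   ≡⟨ ι-* (suc k) (suc n C suc k) ⟨
  ι (suc k ℕ.* (suc n C suc k))   ≡⟨ cong ι (absorption n k) ⟩
  ι (suc n ℕ.* (n C k))           ≡⟨ ι-* (suc n) (n C k) ⟩
  ι (suc n) * ι (n C k)           ≡⟨ cong (ι (suc n) *_) (c≡ι n k) ⟨
  ι (suc n) * c n k               ∎

-- The ratio (n-k)/(k+1) is written (n+1)/(k+1) - 1: no truncated subtraction occurs, and for n = p
-- - 1 the factor is visibly -(1 - p/(k+1)).
c-step : ∀ n k → c n (suc k) ≡ (ι (suc n) * r k - 1ℚ) * c n k
c-step n k = ι-cancelˡ (suc k) (begin
  κ * c n (suc k)
    ≡⟨ solve 3 (λ κ x y → κ :* y := κ :* (x :+ y) :- κ :* x) refl κ (c n k) (c n (suc k)) ⟩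
  κ * (c n k + c n (suc k)) - κ * c n k
    ≡⟨ cong (λ z → κ * z - κ * c n k) (c-pascal n k) ⟨
  κ * c (suc n) (suc k) - κ * c n k
    ≡⟨ cong (_- κ * c n k) (c-absorption n k) ⟩
  ι (suc n) * c n k - κ * c n k
    ≡⟨ solve 3 (λ ν κ x → ν :* x :- κ :* x := (ν :* con 1ℚ :- κ) :* x) refl (ι (suc n)) κ (c n k) ⟩
  (ι (suc n) * 1ℚ - κ) * c n k
    ≡⟨ cong (λ z → (ι (suc n) * z - κ) * c n k) (ι*r k) ⟨
  (ι (suc n) * (κ * r k) - κ) * c n k
    ≡⟨ solve 4 (λ ν κ r x → (ν :* (κ :* r) :- κ) :* x := κ :* ((ν :* r :- con 1ℚ) :* x)) refl (ι (suc n)) κ (r k) (c n k) ⟩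
  κ * ((ι (suc n) * r k - 1ℚ) * c n k) ∎)
  where κ = ι (suc k)

c-r : ∀ n k → r n * c (suc n) (suc k) ≡ c n k * r k
c-r n k = ι-cancelˡ (suc n) (ι-cancelˡ (suc k) (begin
  κ * (ν * (r n * x)) ≡⟨ solve 4 (λ κ ν ρ x → κ :* (ν :* (ρ :* x)) := (ν :* ρ) :* (κ :* x)) refl κ ν (r n) x ⟩
  ν * r n * (κ * x)   ≡⟨ cong₂ _*_ (ι*r n) (c-absorption n k) ⟩
  1ℚ * (ν * y)        ≡⟨ cong (_* (ν * y)) (ι*r k) ⟨
  κ * r k * (ν * y)   ≡⟨ solve 4 (λ κ ν ρ y → κ :* ρ :* (ν :* y) := κ :* (ν :* (y :* ρ))) refl κ ν (r k) y ⟩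
  κ * (ν * (y * r k)) ∎))
  where
  κ = ι (suc k)
  ν = ι (suc n)
  x = c (suc n) (suc k)
  y = c n k

𝔹 : ℕ → (ℕ → ℚ) → ℚ
𝔹 n f = Σ< (suc n) (λ k → c n k * f k)

𝔹-cong : ∀ n {f g} → (∀ k → f k ≡ g k) → 𝔹 n f ≡ 𝔹 n g
𝔹-cong n eq = Σ-cong (suc n) λ k → cong (c n k *_) (eq k)

𝔹-*ˡ : ∀ n a f → 𝔹 n (λ k → a * f k) ≡ a * 𝔹 n f
𝔹-*ˡ n a f = trans
  (Σ-cong (suc n) λ k → solve 3 (λ c a x → c :* (a :* x) := a :* (c :* x)) refl (c n k) a (f k))
  (Σ-*ˡ (suc n) a _)

𝔹-+ : ∀ n f g → 𝔹 n (λ k → f k + g k) ≡ 𝔹 n f + 𝔹 n g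
𝔹-+ n f g = trans
  (Σ-cong (suc n) λ k → ℚₚ.*-distribˡ-+ (c n k) (f k) (g k))
  (Σ-+ (suc n) _ _)

𝔹-head : ∀ n f → 𝔹 (suc n) f ≡ f 0 + Σ< (suc n) (λ k → c (suc n) (suc k) * f (suc k))
𝔹-head n f = trans (Σ-head (suc n) _)
  (cong (_+ Σ< (suc n) (λ k → c (suc n) (suc k) * f (suc k))) (trans (cong (_* f 0) (c-zero (suc n))) (ℚₚ.*-identityˡ (f 0))))

-- Pascal's rule gives two sums. One is `𝔹 n (f ∘ suc)`; the other becomes `𝔹 n f` once the head f 0
-- is put back as its term k = 0 and its surplus last term is dropped, where `c n (suc n)` vanishes.
𝔹-suc : ∀ n f → 𝔹 (suc n) f ≡ 𝔹 n f + 𝔹 n (f ∘ suc)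
𝔹-suc n f = begin
  𝔹 (suc n) f
    ≡⟨ 𝔹-head n f ⟩
  f 0 + Σ< (suc n) (λ k → c (suc n) (suc k) * f (suc k))
    ≡⟨ cong (f 0 +_) (trans (Σ-cong (suc n) λ k →
         trans (cong (_* f (suc k)) (c-pascal n k)) (ℚₚ.*-distribʳ-+ (f (suc k)) (c n k) _))
         (Σ-+ (suc n) _ _)) ⟩
  f 0 + (𝔹 n (f ∘ suc) + Σ< (suc n) (λ k → c n (suc k) * f (suc k)))
    ≡⟨ solve 3 (λ x y z → x :+ (y :+ z) := (con 1ℚ :* x :+ z) :+ y) refl (f 0) (𝔹 n (f ∘ suc)) _ ⟩
  1ℚ * f 0 + Σ< (suc n) (λ k → c n (suc k) * f (suc k)) + 𝔹 n (f ∘ suc)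
    ≡⟨ cong (λ z → z * f 0 + Σ< (suc n) (λ k → c n (suc k) * f (suc k)) + 𝔹 n (f ∘ suc)) (c-zero n) ⟨
  c n 0 * f 0 + Σ< (suc n) (λ k → c n (suc k) * f (suc k)) + 𝔹 n (f ∘ suc)
    ≡⟨ cong (_+ 𝔹 n (f ∘ suc)) (trans (sym (Σ-head (suc n) _)) (Σ-last (suc n) _)) ⟩
  𝔹 n f + c n (suc n) * f (suc n) + 𝔹 n (f ∘ suc)
    ≡⟨ cong (λ z → 𝔹 n f + z * f (suc n) + 𝔹 n (f ∘ suc)) (c-above n) ⟩
  𝔹 n f + 0ℚ * f (suc n) + 𝔹 n (f ∘ suc)
    ≡⟨ solve 3 (λ x y z → x :+ con 0ℚ :* y :+ z := x :+ z) refl (𝔹 n f) (f (suc n)) (𝔹 n (f ∘ suc)) ⟩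
  𝔹 n f + 𝔹 n (f ∘ suc) ∎

𝔹-zero : ∀ f → 𝔹 0 f ≡ f 0
𝔹-zero f = begin
  𝔹 0 f                                         ≡⟨ Σ-head 0 _ ⟩
  c 0 0 * f 0 + Σ< 0 (λ k → c 0 (suc k) * f (suc k)) ≡⟨ cong₂ (λ x y → x * f 0 + y) (c-zero 0) (Σ-zero _) ⟩
  1ℚ * f 0 + 0ℚ                                 ≡⟨ solve 1 (λ x → con 1ℚ :* x :+ con 0ℚ := x) refl (f 0) ⟩
  f 0                                           ∎

-- Since C(n,k)/(k+1) = C(n+1,k+1)/(n+1), dividing by k + 1 lifts the transform to the next row.
-- Only the term k = 0 of that row is missing, hence the correction by `f 0`.
𝔹-absorption : ∀ n f → 𝔹 n (λ k → r k * f (suc k)) ≡ r n * (𝔹 (suc n) f - f 0)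
𝔹-absorption n f = begin
  𝔹 n (λ k → r k * f (suc k))
    ≡⟨ Σ-cong (suc n) (λ k → trans (sym (ℚₚ.*-assoc (c n k) (r k) (f (suc k))))
         (trans (cong (_* f (suc k)) (sym (c-r n k))) (ℚₚ.*-assoc (r n) _ (f (suc k))))) ⟩
  Σ< (suc n) (λ k → r n * (c (suc n) (suc k) * f (suc k)))
    ≡⟨ Σ-*ˡ (suc n) (r n) _ ⟩
  r n * s
    ≡⟨ cong (r n *_) (solve 2 (λ x y → y := x :+ y :- x) refl (f 0) s) ⟩
  r n * (f 0 + s - f 0)
    ≡⟨ cong (λ z → r n * (z - f 0)) (𝔹-head n f) ⟨
  r n * (𝔹 (suc n) f - f 0) ∎
  where s = Σ< (suc n) (λ k → c (suc n) (suc k) * f (suc k))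

binomial-theorem : ∀ x n → 𝔹 n (λ k → ι (x ℕ.^ k)) ≡ ι (suc x ℕ.^ n)
binomial-theorem x zero    = 𝔹-zero _
binomial-theorem x (suc n) = begin
  𝔹 (suc n) (λ k → ι (x ℕ.^ k))
    ≡⟨ 𝔹-suc n _ ⟩
  𝔹 n (λ k → ι (x ℕ.^ k)) + 𝔹 n (λ k → ι (x ℕ.* x ℕ.^ k))
    ≡⟨ cong (𝔹 n (λ k → ι (x ℕ.^ k)) +_)
         (trans (𝔹-cong n λ k → ι-* x (x ℕ.^ k)) (𝔹-*ˡ n (ι x) _)) ⟩
  𝔹 n (λ k → ι (x ℕ.^ k)) + ι x * 𝔹 n (λ k → ι (x ℕ.^ k))
    ≡⟨ cong (λ z → z + ι x * z) (binomial-theorem x n) ⟩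
  ι (suc x ℕ.^ n) + ι x * ι (suc x ℕ.^ n)
    ≡⟨ cong (ι (suc x ℕ.^ n) +_) (ι-* x (suc x ℕ.^ n)) ⟨
  ι (suc x ℕ.^ n) + ι (x ℕ.* suc x ℕ.^ n)
    ≡⟨ ι-+ (suc x ℕ.^ n) _ ⟨
  ι (suc x ℕ.^ suc n) ∎

-- Finite differences and harmonic sums

sign : ℕ → ℚ
sign zero    = 1ℚ
sign (suc k) = - sign k

-- This is (1 - E)^n f at 0 for the shift E, that is, the n-th forward difference at 0 up to the
-- sign (-1)^n.
Δ : ℕ → (ℕ → ℚ) → ℚ
Δ n f = 𝔹 n (λ k → sign k * f k)

Δ-cong : ∀ n {f g} → (∀ k → f k ≡ g k) → Δ n f ≡ Δ n g
Δ-cong n eq = 𝔹-cong n λ k → cong (sign k *_) (eq k)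

Δ-+ : ∀ n f g → Δ n (λ k → f k + g k) ≡ Δ n f + Δ n g
Δ-+ n f g = trans
  (𝔹-cong n λ k → ℚₚ.*-distribˡ-+ (sign k) (f k) (g k))
  (𝔹-+ n (λ k → sign k * f k) (λ k → sign k * g k))

Δ-*ˡ : ∀ n a f → Δ n (λ k → a * f k) ≡ a * Δ n f
Δ-*ˡ n a f = trans
  (𝔹-cong n λ k → solve 3 (λ s a x → s :* (a :* x) := a :* (s :* x)) refl (sign k) a (f k))
  (𝔹-*ˡ n a (λ k → sign k * f k))

𝔹-sign-suc : ∀ n f → 𝔹 n (λ k → sign (suc k) * f k) ≡ - Δ n f
𝔹-sign-suc n f = begin
  𝔹 n (λ k → - sign k * f k)
    ≡⟨ 𝔹-cong n (λ k → solve 2 (λ s x → (:- s) :* x := con (- 1ℚ) :* (s :* x)) refl (sign k) (f k)) ⟩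
  𝔹 n (λ k → (- 1ℚ) * (sign k * f k))
    ≡⟨ 𝔹-*ˡ n (- 1ℚ) (λ k → sign k * f k) ⟩
  (- 1ℚ) * Δ n f
    ≡⟨ solve 1 (λ x → con (- 1ℚ) :* x := :- x) refl (Δ n f) ⟩
  - Δ n f ∎

Δ-suc : ∀ n f → Δ (suc n) f ≡ Δ n f - Δ n (f ∘ suc)
Δ-suc n f = trans (𝔹-suc n (λ k → sign k * f k)) (cong (Δ n f +_) (𝔹-sign-suc n (f ∘ suc)))

Δ-absorption : ∀ n f → Δ n (λ k → r k * f (suc k)) ≡ r n * (f 0 - Δ (suc n) f)
Δ-absorption n f = begin
  Δ n g
    ≡⟨ solve 1 (λ x → x := :- (:- x)) refl (Δ n g) ⟩
  - (- Δ n g)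
    ≡⟨ cong -_ (𝔹-sign-suc n g) ⟨
  - 𝔹 n (λ k → sign (suc k) * (r k * f (suc k)))
    ≡⟨ cong -_ (𝔹-cong n λ k → solve 3 (λ s r x → s :* (r :* x) := r :* (s :* x)) refl (sign (suc k)) (r k) (f (suc k))) ⟩
  - 𝔹 n (λ k → r k * (sign (suc k) * f (suc k)))
    ≡⟨ cong -_ (𝔹-absorption n (λ k → sign k * f k)) ⟩
  - (r n * (Δ (suc n) f - 1ℚ * f 0))
    ≡⟨ solve 3 (λ r d x → :- (r :* (d :- con 1ℚ :* x)) := r :* (x :- d)) refl (r n) (Δ (suc n) f) (f 0) ⟩
  r n * (f 0 - Δ (suc n) f) ∎
  where
  g : ℕ → ℚ
  g k = r k * f (suc k)

Δ-zero : ∀ f → Δ 0 f ≡ f 0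
Δ-zero f = trans (𝔹-zero (λ k → sign k * f k)) (ℚₚ.*-identityˡ (f 0))

Δ-one : ∀ n → Δ (suc n) (λ _ → 1ℚ) ≡ 0ℚ
Δ-one n = trans (Δ-suc n (λ _ → 1ℚ)) (ℚₚ.+-inverseʳ (Δ n (λ _ → 1ℚ)))

-- The shift `s` makes the induction close. In (k+s)^(m+1) = k (k+s)^m + s (k+s)^m, absorption
-- removes the factor k of the first summand at the price of one order of difference and of
-- replacing k by k + 1, that is, `s` by `suc s`.
Δ-power : ∀ n m s → m ≤ n → Δ (suc n) (λ k → ι ((k ℕ.+ s) ℕ.^ m)) ≡ 0ℚ
Δ-power n zero s _ = trans (Δ-cong (suc n) {g = λ _ → 1ℚ} λ _ → sym (fromNat≡ι 1)) (Δ-one n)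
Δ-power (suc n) (suc m) s (s≤s m≤n) = begin
  Δ (suc (suc n)) (λ k → ι ((k ℕ.+ s) ℕ.* (k ℕ.+ s) ℕ.^ m))
    ≡⟨ Δ-cong (suc (suc n)) (λ k → trans (ι-* (k ℕ.+ s) _)
         (trans (cong (_* F k) (ι-+ k s)) (ℚₚ.*-distribʳ-+ (F k) (ι k) (ι s)))) ⟩
  Δ (suc (suc n)) (λ k → G k + ι s * F k)
    ≡⟨ trans (Δ-+ (suc (suc n)) G (λ k → ι s * F k)) (cong (Δ (suc (suc n)) G +_) (Δ-*ˡ (suc (suc n)) (ι s) F)) ⟩
  Δ (suc (suc n)) G + ι s * Δ (suc (suc n)) F
    ≡⟨ cong₂ (λ x y → x + ι s * y) G≡0 (Δ-power (suc n) m s (ℕₚ.m≤n⇒m≤1+n m≤n)) ⟩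
  0ℚ + ι s * 0ℚ
    ≡⟨ solve 1 (λ x → con 0ℚ :+ x :* con 0ℚ := con 0ℚ) refl (ι s) ⟩
  0ℚ ∎
  where
  F G : ℕ → ℚ
  F k = ι ((k ℕ.+ s) ℕ.^ m)
  G k = ι k * F k

  G0 : G 0 ≡ 0ℚ
  G0 = trans (cong (_* F 0) (sym (fromNat≡ι 0))) (ℚₚ.*-zeroˡ (F 0))

  G-suc : ∀ k → r k * G (suc k) ≡ ι ((k ℕ.+ suc s) ℕ.^ m)
  G-suc k = begin
    r k * (ι (suc k) * F (suc k)) ≡⟨ solve 3 (λ r k x → r :* (k :* x) := k :* r :* x) refl (r k) (ι (suc k)) (F (suc k)) ⟩
    ι (suc k) * r k * F (suc k)   ≡⟨ cong (_* F (suc k)) (ι*r k) ⟩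
    1ℚ * F (suc k)                ≡⟨ ℚₚ.*-identityˡ (F (suc k)) ⟩
    F (suc k)                     ≡⟨ cong (λ x → ι (x ℕ.^ m)) (ℕₚ.+-suc k s) ⟨
    ι ((k ℕ.+ suc s) ℕ.^ m)       ∎

  G≡0 : Δ (suc (suc n)) G ≡ 0ℚ
  G≡0 = begin
    D
      ≡⟨ solve 1 (λ d → d := con 0ℚ :- con 1ℚ :* (con 0ℚ :- d)) refl D ⟩
    0ℚ - 1ℚ * (0ℚ - D)
      ≡⟨ cong₂ (λ x y → 0ℚ - x * (y - D)) (ι*r (suc n)) G0 ⟨
    0ℚ - ι (suc (suc n)) * r (suc n) * (G 0 - D)
      ≡⟨ cong (λ z → 0ℚ - z) (ℚₚ.*-assoc (ι (suc (suc n))) (r (suc n)) (G 0 - D)) ⟩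
    0ℚ - ι (suc (suc n)) * (r (suc n) * (G 0 - D))
      ≡⟨ cong (λ z → 0ℚ - ι (suc (suc n)) * z) (Δ-absorption (suc n) G) ⟨
    0ℚ - ι (suc (suc n)) * Δ (suc n) (λ k → r k * G (suc k))
      ≡⟨ cong (λ z → 0ℚ - ι (suc (suc n)) * z) (trans (Δ-cong (suc n) G-suc) (Δ-power n m (suc s) m≤n)) ⟩
    0ℚ - ι (suc (suc n)) * 0ℚ
      ≡⟨ solve 1 (λ x → con 0ℚ :- x :* con 0ℚ := con 0ℚ) refl (ι (suc (suc n))) ⟩
    0ℚ ∎
    where D = Δ (suc (suc n)) G

h h₂ h₃ : ℕ → ℚ
h  n = Σ< n r
h₂ n = Σ< n (λ k → r k * r k)
h₃ n = Σ< n (λ k → r k * (r k * r k))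

h-zero : h 0 ≡ 0ℚ
h-zero = Σ-zero r

h-suc : ∀ n → h (suc n) ≡ h n + r n
h-suc n = Σ-last n r

h₂-zero : h₂ 0 ≡ 0ℚ
h₂-zero = Σ-zero _

h₂-suc : ∀ n → h₂ (suc n) ≡ h₂ n + r n * r n
h₂-suc n = Σ-last n _

-- The unshifted 1/k. The value 0 at 0 reduces a difference to its terms with k ≥ 1 and removes the
-- constant from `Δ-absorption`.
reciprocal : ℕ → ℚ
reciprocal zero    = 0ℚ
reciprocal (suc k) = r k

-- From n to n + 1 the difference changes by `- Δ n r`, which absorption evaluates to `- r n`
-- because differences of a constant vanish.
Δ-reciprocal : ∀ n → Δ n reciprocal ≡ - h n
Δ-reciprocal zero    = trans (Δ-zero reciprocal) (cong -_ (sym h-zero))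
Δ-reciprocal (suc n) = begin
  Δ (suc n) reciprocal
    ≡⟨ Δ-suc n reciprocal ⟩
  Δ n reciprocal - Δ n r
    ≡⟨ cong (λ z → Δ n reciprocal - z) (trans (Δ-cong n λ k → sym (ℚₚ.*-identityʳ (r k))) (Δ-absorption n (λ _ → 1ℚ))) ⟩
  Δ n reciprocal - r n * (1ℚ - Δ (suc n) (λ _ → 1ℚ))
    ≡⟨ cong₂ (λ x y → x - r n * (1ℚ - y)) (Δ-reciprocal n) (Δ-one n) ⟩
  - h n - r n * (1ℚ - 0ℚ)
    ≡⟨ solve 2 (λ h r → (:- h) :- r :* (con 1ℚ :- con 0ℚ) := :- (h :+ r)) refl (h n) (r n) ⟩
  - (h n + r n)
    ≡⟨ cong -_ (h-suc n) ⟨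
  - h (suc n) ∎

-- `Δ-suc` leaves only the increments 1/(k+1)² of `h₂`, and these are one absorption away from
-- `Δ-reciprocal`.
Δ-h₂ : ∀ n → Δ (suc n) h₂ ≡ - (r n * h (suc n))
Δ-h₂ n = begin
  Δ (suc n) h₂
    ≡⟨ Δ-suc n h₂ ⟩
  Δ n h₂ - Δ n (h₂ ∘ suc)
    ≡⟨ cong (λ z → Δ n h₂ - z) (trans (Δ-cong n h₂-suc) (Δ-+ n h₂ (λ k → r k * r k))) ⟩
  Δ n h₂ - (Δ n h₂ + Δ n (λ k → r k * r k))
    ≡⟨ cong (λ z → Δ n h₂ - (Δ n h₂ + z)) (Δ-absorption n reciprocal) ⟩
  Δ n h₂ - (Δ n h₂ + r n * (0ℚ - Δ (suc n) reciprocal))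
    ≡⟨ cong (λ z → Δ n h₂ - (Δ n h₂ + r n * (0ℚ - z))) (Δ-reciprocal (suc n)) ⟩
  Δ n h₂ - (Δ n h₂ + r n * (0ℚ - (- h (suc n))))
    ≡⟨ solve 3 (λ d r h → d :- (d :+ r :* (con 0ℚ :- (:- h))) := :- (r :* h)) refl (Δ n h₂) (r n) (h (suc n)) ⟩
  - (r n * h (suc n)) ∎

h₂/k : ℕ → ℚ
h₂/k zero    = 0ℚ
h₂/k (suc k) = r k * h₂ (suc k)

-- Absorption reduces the step in n to `Δ-h₂`, so each step contributes one term H_(n+1)/(n+1)².
Δ-h₂/k : ∀ n → Δ n h₂/k ≡ - Σ< n (λ k → h (suc k) * (r k * r k))
Δ-h₂/k zero    = trans (Δ-zero h₂/k) (cong -_ (sym (Σ-zero _)))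
Δ-h₂/k (suc n) = begin
  Δ (suc n) h₂/k
    ≡⟨ Δ-suc n h₂/k ⟩
  Δ n h₂/k - Δ n (λ k → r k * h₂ (suc k))
    ≡⟨ cong (λ z → Δ n h₂/k - z) (Δ-absorption n h₂) ⟩
  Δ n h₂/k - r n * (h₂ 0 - Δ (suc n) h₂)
    ≡⟨ cong₂ (λ x y → Δ n h₂/k - r n * (x - y)) h₂-zero (Δ-h₂ n) ⟩
  Δ n h₂/k - r n * (0ℚ - (- (r n * h (suc n))))
    ≡⟨ cong (λ x → x - r n * (0ℚ - (- (r n * h (suc n))))) (Δ-h₂/k n) ⟩
  - A - r n * (0ℚ - (- (r n * h (suc n))))
    ≡⟨ solve 3 (λ a r h → (:- a) :- r :* (con 0ℚ :- (:- (r :* h))) := :- (a :+ h :* (r :* r))) refl A (r n) (h (suc n)) ⟩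
  - (A + h (suc n) * (r n * r n))
    ≡⟨ cong -_ (Σ-last n _) ⟨
  - Σ< (suc n) (λ k → h (suc k) * (r k * r k)) ∎
  where A = Σ< n (λ k → h (suc k) * (r k * r k))

-- Central binomial coefficients

opaque
  unfolding Σ<

  ∑₁≡Σ< : ∀ n (f : (k : ℕ) → .{{NonZero k}} → ℚ) → ∑₁ n f ≡ Σ< n (λ k → f (suc k))
  ∑₁≡Σ< n f = refl

  ∑₀≡Σ< : ∀ n f → ∑₀ n f ≡ Σ< (suc n) f
  ∑₀≡Σ< n f = refl

opaque
  a : ℕ → ℚ
  a = centralBinom/4^

  a≡ : ∀ k → centralBinom/4^ k ≡ a k
  a≡ k = refl

ι*1/ : ∀ m .{{_ : NonZero m}} {x} → ι m * x ≡ 1ℚ → ℤ.1ℤ / m ≡ x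
ι*1/ m eq = sym (/-unique ℤ.1ℤ m eq)

H⟨1⟩≡h : ∀ n → H n ⟨ 1 ⟩ ≡ h n
H⟨1⟩≡h n = trans (∑₁≡Σ< n (λ k → (ℤ.1ℤ / (k ℕ.^ 1)) {{ℕₚ.m^n≢0 k 1}})) (Σ-cong n λ k →
  ι*1/ (suc k ℕ.^ 1) {{ℕₚ.m^n≢0 (suc k) 1}} (trans (cong (λ m → ι m * r k) (ℕₚ.^-identityʳ (suc k))) (ι*r k)))

H⟨2⟩≡h₂ : ∀ n → H n ⟨ 2 ⟩ ≡ h₂ n
H⟨2⟩≡h₂ n = trans (∑₁≡Σ< n (λ k → (ℤ.1ℤ / (k ℕ.^ 2)) {{ℕₚ.m^n≢0 k 2}})) (Σ-cong n λ k →
  ι*1/ (suc k ℕ.^ 2) {{ℕₚ.m^n≢0 (suc k) 2}} (begin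
    ι (suc k ℕ.^ 2) * (r k * r k)
      ≡⟨ cong (λ m → ι (suc k ℕ.* m) * (r k * r k)) (ℕₚ.^-identityʳ (suc k)) ⟩
    ι (suc k ℕ.* suc k) * (r k * r k)
      ≡⟨ cong (_* (r k * r k)) (ι-* (suc k) (suc k)) ⟩
    ι (suc k) * ι (suc k) * (r k * r k)
      ≡⟨ solve 2 (λ x y → x :* x :* (y :* y) := (x :* y) :* (x :* y)) refl (ι (suc k)) (r k) ⟩
    ι (suc k) * r k * (ι (suc k) * r k)
      ≡⟨ cong₂ _*_ (ι*r k) (ι*r k) ⟩
    1ℚ ∎))

ι4^*a : ∀ k → ι (4 ℕ.^ k) * a k ≡ c (k ℕ.+ k) k
ι4^*a k = begin
  ι (4 ℕ.^ k) * a k              ≡⟨ cong (ι (4 ℕ.^ k) *_) (a≡ k) ⟨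
  ι (4 ℕ.^ k) * centralBinom/4^ k ≡⟨ ι*/ (ℤ.+ ((2 ℕ.* k) C k)) (4 ℕ.^ k) {{ℕₚ.m^n≢0 4 k}} ⟩
  fromNat ((2 ℕ.* k) C k)        ≡⟨ fromNat≡ι _ ⟩
  ι ((2 ℕ.* k) C k)              ≡⟨ cong (λ m → ι ((k ℕ.+ m) C k)) (ℕₚ.+-identityʳ k) ⟩
  ι ((k ℕ.+ k) C k)              ≡⟨ c≡ι (k ℕ.+ k) k ⟨
  c (k ℕ.+ k) k                  ∎

centralBinom/k4^≡ : ∀ k → centralBinom/k4^ (suc k) ≡ a (suc k) * r k
centralBinom/k4^≡ k = sym (/-unique (ℤ.+ ((2 ℕ.* suc k) C suc k)) d {{ℕₚ.m*n≢0 (suc k) (4 ℕ.^ suc k) {{it}} {{ℕₚ.m^n≢0 4 (suc k)}}}} (begin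
  ι d * (a (suc k) * r k)
    ≡⟨ cong (_* (a (suc k) * r k)) (ι-* (suc k) (4 ℕ.^ suc k)) ⟩
  ι (suc k) * ι (4 ℕ.^ suc k) * (a (suc k) * r k)
    ≡⟨ solve 4 (λ x y a r → x :* y :* (a :* r) := (x :* r) :* (y :* a)) refl (ι (suc k)) (ι (4 ℕ.^ suc k)) (a (suc k)) (r k) ⟩
  ι (suc k) * r k * (ι (4 ℕ.^ suc k) * a (suc k))
    ≡⟨ cong₂ (λ x y → x * (ι (4 ℕ.^ suc k) * y)) (ι*r k) (sym (a≡ (suc k))) ⟩
  1ℚ * (ι (4 ℕ.^ suc k) * centralBinom/4^ (suc k))
    ≡⟨ ℚₚ.*-identityˡ _ ⟩
  ι (4 ℕ.^ suc k) * centralBinom/4^ (suc k)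
    ≡⟨ ι*/ (ℤ.+ ((2 ℕ.* suc k) C suc k)) (4 ℕ.^ suc k) {{ℕₚ.m^n≢0 4 (suc k)}} ⟩
  fromNat ((2 ℕ.* suc k) C suc k) ∎))
  where d = suc k ℕ.* 4 ℕ.^ suc k

-- The ratio in `c-step` is here (2k+2)/(k+1) - 1 = 1.
c-middle : ∀ k → c (suc (k ℕ.+ k)) (suc k) ≡ c (suc (k ℕ.+ k)) k
c-middle k = begin
  c (suc (k ℕ.+ k)) (suc k)
    ≡⟨ c-step (suc (k ℕ.+ k)) k ⟩
  (ι (suc (suc (k ℕ.+ k))) * r k - 1ℚ) * x
    ≡⟨ cong (λ m → (ι (suc m) * r k - 1ℚ) * x) (ℕₚ.+-suc k k) ⟨
  (ι (suc k ℕ.+ suc k) * r k - 1ℚ) * x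
    ≡⟨ cong (λ z → (z * r k - 1ℚ) * x) (ι-double (suc k)) ⟩
  (2ℚ * ι (suc k) * r k - 1ℚ) * x
    ≡⟨ cong (λ z → (z - 1ℚ) * x) (trans (ℚₚ.*-assoc 2ℚ (ι (suc k)) (r k)) (cong (2ℚ *_) (ι*r k))) ⟩
  (2ℚ * 1ℚ - 1ℚ) * x
    ≡⟨ ℚₚ.*-identityˡ x ⟩
  x ∎
  where x = c (suc (k ℕ.+ k)) k

ι-odd : ∀ k → ι (suc (k ℕ.+ k)) ≡ 1ℚ + 2ℚ * ι k
ι-odd k = trans (ι-suc (k ℕ.+ k)) (cong (1ℚ +_) (ι-double k))

c-central-suc : ∀ k → ι (suc k) * c (suc k ℕ.+ suc k) (suc k) ≡ 2ℚ * ((1ℚ + 2ℚ * ι k) * c (k ℕ.+ k) k)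
c-central-suc k = begin
  ι (suc k) * c (suc (k ℕ.+ suc k)) (suc k)
    ≡⟨ c-absorption (k ℕ.+ suc k) k ⟩
  ι (suc k ℕ.+ suc k) * c (k ℕ.+ suc k) k
    ≡⟨ cong₂ (λ x m → x * c m k) (ι-double (suc k)) (ℕₚ.+-suc k k) ⟩
  2ℚ * ι (suc k) * c (suc (k ℕ.+ k)) k
    ≡⟨ cong (2ℚ * ι (suc k) *_) (c-middle k) ⟨
  2ℚ * ι (suc k) * c (suc (k ℕ.+ k)) (suc k)
    ≡⟨ ℚₚ.*-assoc 2ℚ (ι (suc k)) _ ⟩
  2ℚ * (ι (suc k) * c (suc (k ℕ.+ k)) (suc k))
    ≡⟨ cong (2ℚ *_) (trans (c-absorption (k ℕ.+ k) k) (cong (_* c (k ℕ.+ k) k) (ι-odd k))) ⟩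
  2ℚ * ((1ℚ + 2ℚ * ι k) * c (k ℕ.+ k) k) ∎

ι2 : ι 2 ≡ 2ℚ
ι2 = sym (fromNat≡ι 2)

a-suc : ∀ k → 2ℚ * (ι (suc k) * a (suc k)) ≡ (1ℚ + 2ℚ * ι k) * a k
a-suc k = ι-cancelˡ (4 ℕ.^ k) {{ℕₚ.m^n≢0 4 k}} (ι-cancelˡ 2 (begin
  ι 2 * (f * (2ℚ * (κ * a (suc k))))
    ≡⟨ cong (λ z → z * (f * (2ℚ * (κ * a (suc k))))) ι2 ⟩
  2ℚ * (f * (2ℚ * (κ * a (suc k))))
    ≡⟨ solve 3 (λ f κ a → con 2ℚ :* (f :* (con 2ℚ :* (κ :* a))) := κ :* (con 4ℚ :* f :* a)) refl f κ (a (suc k)) ⟩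
  κ * (4ℚ * f * a (suc k))
    ≡⟨ cong (λ z → κ * (z * f * a (suc k))) (fromNat≡ι 4) ⟩
  κ * (ι 4 * f * a (suc k))
    ≡⟨ cong (λ z → κ * (z * a (suc k))) (ι-* 4 (4 ℕ.^ k)) ⟨
  κ * (ι (4 ℕ.^ suc k) * a (suc k))
    ≡⟨ cong (κ *_) (ι4^*a (suc k)) ⟩
  κ * c (suc k ℕ.+ suc k) (suc k)
    ≡⟨ c-central-suc k ⟩
  2ℚ * ((1ℚ + 2ℚ * ι k) * c (k ℕ.+ k) k)
    ≡⟨ cong (λ z → 2ℚ * ((1ℚ + 2ℚ * ι k) * z)) (ι4^*a k) ⟨
  2ℚ * ((1ℚ + 2ℚ * ι k) * (f * a k))
    ≡⟨ solve 3 (λ f κ a → con 2ℚ :* ((con 1ℚ :+ con 2ℚ :* κ) :* (f :* a)) := con 2ℚ :* (f :* ((con 1ℚ :+ con 2ℚ :* κ) :* a))) refl f (ι k) (a k) ⟩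
  2ℚ * (f * ((1ℚ + 2ℚ * ι k) * a k))
    ≡⟨ cong (λ z → z * (f * ((1ℚ + 2ℚ * ι k) * a k))) ι2 ⟨
  ι 2 * (f * ((1ℚ + 2ℚ * ι k) * a k)) ∎))
  where
  f = ι (4 ℕ.^ k)
  κ = ι (suc k)

-- G n = ∑_{k≤n} a k, by G-suc.
G : ℕ → ℚ
G n = (1ℚ + 2ℚ * ι n) * a n

G-zero : G 0 ≡ 1ℚ
G-zero = begin
  (1ℚ + 2ℚ * ι 0) * a 0 ≡⟨ cong₂ (λ x y → (1ℚ + 2ℚ * x) * y) (sym (fromNat≡ι 0)) (sym (a≡ 0)) ⟩
  1ℚ                    ∎

G-suc : ∀ n → G (suc n) ≡ G n + a (suc n)
G-suc n = begin
  (1ℚ + 2ℚ * ι (suc n)) * a (suc n)             ≡⟨ solve 2 (λ n a → (con 1ℚ :+ con 2ℚ :* n) :* a := con 2ℚ :* (n :* a) :+ a) refl (ι (suc n)) (a (suc n)) ⟩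
  2ℚ * (ι (suc n) * a (suc n)) + a (suc n)      ≡⟨ cong (_+ a (suc n)) (a-suc n) ⟩
  G n + a (suc n)                               ∎

-- The correction term of both summations by parts: the partial sum of `a` times the increment of
-- the harmonic number.
G*r : ∀ n → G n * r n ≡ 2ℚ * a (suc n)
G*r n = begin
  G n * r n                                ≡⟨ cong (_* r n) (a-suc n) ⟨
  2ℚ * (ι (suc n) * a (suc n)) * r n       ≡⟨ solve 3 (λ x a r → con 2ℚ :* (x :* a) :* r := (x :* r) :* (con 2ℚ :* a)) refl (ι (suc n)) (a (suc n)) (r n) ⟩
  ι (suc n) * r n * (2ℚ * a (suc n))       ≡⟨ cong (_* (2ℚ * a (suc n))) (ι*r n) ⟩
  1ℚ * (2ℚ * a (suc n))                    ≡⟨ ℚₚ.*-identityˡ _ ⟩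
  2ℚ * a (suc n)                           ∎

-- By parts, `G n * h n` is corrected by the sum of G k/(k+1) = 2 a_(k+1) over k < n, which is 2 (G
-- n - 1); this is the origin of both constants 2.
Σ-a*h : ∀ n → Σ< n (λ k → a (suc k) * h (suc k)) ≡ G n * (h n - 2ℚ) + 2ℚ
Σ-a*h zero    = trans (Σ-zero _) (sym (cong₂ (λ x y → x * (y - 2ℚ) + 2ℚ) G-zero h-zero))
Σ-a*h (suc n) = begin
  Σ< (suc n) (λ k → a (suc k) * h (suc k))
    ≡⟨ Σ-last n _ ⟩
  Σ< n (λ k → a (suc k) * h (suc k)) + a (suc n) * h (suc n)
    ≡⟨ cong₂ (λ x y → x + a (suc n) * y) (Σ-a*h n) (h-suc n) ⟩
  G n * (h n - 2ℚ) + 2ℚ + a (suc n) * (h n + r n)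
    ≡⟨ solve 4 (λ g h r a → g :* (h :- con 2ℚ) :+ con 2ℚ :+ a :* (h :+ r)
                := (g :+ a) :* (h :+ r :- con 2ℚ) :+ con 2ℚ :+ (con 2ℚ :* a :- g :* r)) refl (G n) (h n) (r n) (a (suc n)) ⟩
  (G n + a (suc n)) * (h n + r n - 2ℚ) + 2ℚ + (2ℚ * a (suc n) - G n * r n)
    ≡⟨ cong (λ z → (G n + a (suc n)) * (h n + r n - 2ℚ) + 2ℚ + (2ℚ * a (suc n) - z)) (G*r n) ⟩
  (G n + a (suc n)) * (h n + r n - 2ℚ) + 2ℚ + (2ℚ * a (suc n) - 2ℚ * a (suc n))
    ≡⟨ solve 2 (λ x y → x :+ (y :- y) := x) refl ((G n + a (suc n)) * (h n + r n - 2ℚ) + 2ℚ) (2ℚ * a (suc n)) ⟩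
  (G n + a (suc n)) * (h n + r n - 2ℚ) + 2ℚ
    ≡⟨ cong₂ (λ x y → x * (y - 2ℚ) + 2ℚ) (G-suc n) (h-suc n) ⟨
  G (suc n) * (h (suc n) - 2ℚ) + 2ℚ ∎

Σ-a*h₂ : ∀ n → Σ< n (λ k → a (suc k) * h₂ (suc k)) ≡ G n * h₂ n - 2ℚ * Σ< n (λ k → a (suc k) * r k)
Σ-a*h₂ zero    = trans (Σ-zero _) (sym (trans (cong₂ (λ x y → G 0 * x - 2ℚ * y) h₂-zero (Σ-zero _))
  (solve 1 (λ g → g :* con 0ℚ :- con 2ℚ :* con 0ℚ := con 0ℚ) refl (G 0))))
Σ-a*h₂ (suc n) = begin
  Σ< (suc n) (λ k → a (suc k) * h₂ (suc k))
    ≡⟨ Σ-last n _ ⟩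
  Σ< n (λ k → a (suc k) * h₂ (suc k)) + a (suc n) * h₂ (suc n)
    ≡⟨ cong₂ (λ x y → x + a (suc n) * y) (Σ-a*h₂ n) (h₂-suc n) ⟩
  G n * h₂ n - 2ℚ * s + a (suc n) * (h₂ n + r n * r n)
    ≡⟨ solve 5 (λ g h s r a → g :* h :- con 2ℚ :* s :+ a :* (h :+ r :* r)
                := (g :+ a) :* (h :+ r :* r) :- con 2ℚ :* s :- (g :* r) :* r) refl (G n) (h₂ n) s (r n) (a (suc n)) ⟩
  (G n + a (suc n)) * (h₂ n + r n * r n) - 2ℚ * s - G n * r n * r n
    ≡⟨ cong (λ z → (G n + a (suc n)) * (h₂ n + r n * r n) - 2ℚ * s - z * r n) (G*r n) ⟩
  (G n + a (suc n)) * (h₂ n + r n * r n) - 2ℚ * s - 2ℚ * a (suc n) * r n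
    ≡⟨ solve 4 (λ x s a r → x :- con 2ℚ :* s :- con 2ℚ :* a :* r := x :- con 2ℚ :* (s :+ a :* r)) refl ((G n + a (suc n)) * (h₂ n + r n * r n)) s (a (suc n)) (r n) ⟩
  (G n + a (suc n)) * (h₂ n + r n * r n) - 2ℚ * (s + a (suc n) * r n)
    ≡⟨ cong₂ (λ x y → x - 2ℚ * y) (cong₂ _*_ (G-suc n) (h₂-suc n)) (Σ-last n _) ⟨
  G (suc n) * h₂ (suc n) - 2ℚ * Σ< (suc n) (λ k → a (suc k) * r k) ∎
  where s = Σ< n (λ k → a (suc k) * r k)

-- In this form, n = p - 1 shows an explicit factor p in front of C(p + (p-1), p-1), a coefficient
-- that `c-shift` evaluates.
ι4^*G : ∀ n → ι (4 ℕ.^ n) * G n ≡ ι (suc n) * c (suc n ℕ.+ n) n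
ι4^*G n = begin
  ι (4 ℕ.^ n) * ((1ℚ + 2ℚ * ι n) * a n)
    ≡⟨ solve 3 (λ f x a → f :* (x :* a) := x :* (f :* a)) refl (ι (4 ℕ.^ n)) (1ℚ + 2ℚ * ι n) (a n) ⟩
  (1ℚ + 2ℚ * ι n) * (ι (4 ℕ.^ n) * a n)
    ≡⟨ cong₂ _*_ (sym (ι-odd n)) (ι4^*a n) ⟩
  ι (suc (n ℕ.+ n)) * c (n ℕ.+ n) n
    ≡⟨ c-absorption (n ℕ.+ n) n ⟨
  ι (suc n) * c (suc (n ℕ.+ n)) (suc n)
    ≡⟨ cong (ι (suc n) *_) (c-middle n) ⟩
  ι (suc n) * c (suc n ℕ.+ n) n ∎

-- Iterated, this writes C(m+k, k) as the product of 1 + m/j over 1 ≤ j ≤ k.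
c-shift-suc : ∀ m k → c (m ℕ.+ suc k) (suc k) ≡ (1ℚ + ι m * r k) * c (m ℕ.+ k) k
c-shift-suc m k = ι-cancelˡ (suc k) (begin
  κ * c (m ℕ.+ suc k) (suc k)       ≡⟨ cong (λ l → κ * c l (suc k)) (ℕₚ.+-suc m k) ⟩
  κ * c (suc (m ℕ.+ k)) (suc k)     ≡⟨ c-absorption (m ℕ.+ k) k ⟩
  ι (suc (m ℕ.+ k)) * x             ≡⟨ cong (λ l → ι l * x) (ℕₚ.+-suc m k) ⟨
  ι (m ℕ.+ suc k) * x               ≡⟨ cong (_* x) (ι-+ m (suc k)) ⟩
  (ι m + κ) * x                     ≡⟨ solve 3 (λ m κ x → (m :+ κ) :* x := (m :* con 1ℚ :+ κ) :* x) refl (ι m) κ x ⟩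
  (ι m * 1ℚ + κ) * x                ≡⟨ cong (λ z → (ι m * z + κ) * x) (ι*r k) ⟨
  (ι m * (κ * r k) + κ) * x         ≡⟨ solve 4 (λ m κ r x → (m :* (κ :* r) :+ κ) :* x := κ :* ((con 1ℚ :+ m :* r) :* x)) refl (ι m) κ (r k) x ⟩
  κ * ((1ℚ + ι m * r k) * x)        ∎)
  where
  κ = ι (suc k)
  x = c (m ℕ.+ k) k

-- Power sums and the Bernoulli recurrence

c-subdiagonal : ∀ n → c (suc n) n ≡ ι (suc n)
c-subdiagonal zero    = trans (c-zero 1) (fromNat≡ι 1)
c-subdiagonal (suc n) = begin
  c (suc (suc n)) (suc n)            ≡⟨ c-pascal (suc n) n ⟩
  c (suc n) n + c (suc n) (suc n)    ≡⟨ cong₂ _+_ (c-subdiagonal n) (c-diag (suc n)) ⟩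
  ι (suc n) + 1ℚ                     ≡⟨ ℚₚ.+-comm (ι (suc n)) 1ℚ ⟩
  1ℚ + ι (suc n)                     ≡⟨ ι-suc (suc n) ⟨
  ι (suc (suc n))                    ∎

𝔹-last : ∀ n f → 𝔹 n f ≡ Σ< n (λ k → c n k * f k) + f n
𝔹-last n f = trans (Σ-last n _)
  (cong (Σ< n (λ k → c n k * f k) +_) (trans (cong (_* f n) (c-diag n)) (ℚₚ.*-identityˡ (f n))))

-- The sum of (k+1)^(m+1) - k^(m+1) over k < x telescopes, and the binomial theorem expands each
-- difference. The convention 0^0 = 1 is in force, and the coefficients are those of the Bernoulli
-- recurrence.
power-sum-recurrence : ∀ m x →
  Σ< (suc m) (λ j → c (suc m) j * Σ< x (λ k → ι (k ℕ.^ j))) ≡ ι (x ℕ.^ suc m)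
power-sum-recurrence m zero = begin
  Σ< (suc m) (λ j → c (suc m) j * Σ< 0 (λ k → ι (k ℕ.^ j)))
    ≡⟨ Σ-cong (suc m) (λ j → trans (cong (c (suc m) j *_) (Σ-zero _))
         (solve 1 (λ x → x :* con 0ℚ := con 0ℚ :* x) refl (c (suc m) j))) ⟩
  Σ< (suc m) (λ j → 0ℚ * c (suc m) j)
    ≡⟨ Σ-*ˡ (suc m) 0ℚ _ ⟩
  0ℚ * Σ< (suc m) (c (suc m))
    ≡⟨ ℚₚ.*-zeroˡ (Σ< (suc m) (c (suc m))) ⟩
  0ℚ
    ≡⟨ fromNat≡ι 0 ⟩
  ι (0 ℕ.^ suc m) ∎
power-sum-recurrence m (suc x) = begin
  Σ< (suc m) (λ j → c (suc m) j * Σ< (suc x) (λ k → ι (k ℕ.^ j)))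
    ≡⟨ Σ-cong (suc m) (λ j → trans (cong (c (suc m) j *_) (Σ-last x _)) (ℚₚ.*-distribˡ-+ (c (suc m) j) _ _)) ⟩
  Σ< (suc m) (λ j → c (suc m) j * Σ< x (λ k → ι (k ℕ.^ j)) + c (suc m) j * ι (x ℕ.^ j))
    ≡⟨ Σ-+ (suc m) _ _ ⟩
  Σ< (suc m) (λ j → c (suc m) j * Σ< x (λ k → ι (k ℕ.^ j))) + s
    ≡⟨ cong (_+ s) (power-sum-recurrence m x) ⟩
  ι (x ℕ.^ suc m) + s
    ≡⟨ ℚₚ.+-comm (ι (x ℕ.^ suc m)) s ⟩
  s + ι (x ℕ.^ suc m)
    ≡⟨ 𝔹-last (suc m) (λ j → ι (x ℕ.^ j)) ⟨
  𝔹 (suc m) (λ j → ι (x ℕ.^ j))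
    ≡⟨ binomial-theorem x (suc m) ⟩
  ι (suc x ℕ.^ suc m) ∎
  where s = Σ< (suc m) (λ j → c (suc m) j * ι (x ℕ.^ j))

opaque
  B : ℕ → ℚ
  B = bernoulli

  bernoulli≡B : ∀ m → bernoulli m ≡ B m
  bernoulli≡B m = refl

B-recurrence : ∀ n → Σ< (suc (suc n)) (λ k → c (suc (suc n)) k * B k) ≡ 0ℚ
B-recurrence n = begin
  Σ< (suc (suc n)) (λ k → c (suc (suc n)) k * B k)
    ≡⟨ Σ-cong (suc (suc n)) (λ k → cong₂ _*_
         (trans (c≡ι (suc (suc n)) k) (trans (cong (λ m → ι (m C k)) (sym (ℕₚ.+-comm (suc n) 1))) (sym (fromNat≡ι _))))
         (sym (bernoulli≡B k))) ⟩
  Σ< (suc (suc n)) (λ k → fromNat ((suc n ℕ.+ 1) C k) * bernoulli k)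
    ≡⟨ ∑₀≡Σ< (suc n) _ ⟨
  ∑₀ (suc n) (λ k → fromNat ((suc n ℕ.+ 1) C k) * bernoulli k)
    ≡⟨ bernoulli-recurrence n ⟩
  0ℚ ∎

B-zero : Σ< 1 (λ k → c 1 k * B k) ≡ 1ℚ
B-zero = begin
  Σ< 1 (λ k → c 1 k * B k) ≡⟨ trans (Σ-last 0 _) (cong₂ _+_ (Σ-zero _) (cong₂ _*_ (c-zero 1) (sym (bernoulli≡B 0)))) ⟩
  0ℚ + 1ℚ * bernoulli 0    ≡⟨ cong (λ b → 0ℚ + 1ℚ * b) bernoulli-zero ⟩
  0ℚ + 1ℚ * 1ℚ             ≡⟨⟩
  1ℚ                       ∎

-- Divisibility of rationals by powers of a prime

module AtPrime (N : ℕ) (pr : Prime (suc N)) where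

  p : ℕ
  p = suc N

  π : ℚ
  π = ι p

  ∤-* : ∀ {m n} → ¬ (p ∣ m) → ¬ (p ∣ n) → ¬ (p ∣ m ℕ.* n)
  ∤-* {m} {n} p∤m p∤n p∣mn = [ p∤m , p∤n ]′ (euclidsLemma m n pr p∣mn)

  <⇒∤ : ∀ {k} → suc k < p → ¬ (p ∣ suc k)
  <⇒∤ = >⇒∤

  opaque
    unfolding ι

    ↧*≡↥ : ∀ x → ι (↧ₙ x) * x ≡ (↥ x) / 1
    ↧*≡↥ x@record{} = trans (cong (ι (↧ₙ x) *_) (sym (ℚₚ.↥p/↧p≡p x))) (ι*/ (↥ x) (↧ₙ x))

    -- If d x = z and x = n/e' in lowest terms, then d n = z e', so e' divides d. Any denominator
    -- prime to p, reduced or not, therefore certifies integrality.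
    integral : ∀ d z {x} → ¬ (p ∣ d) → ι d * x ≡ z / 1 → Integral p x
    integral d z {x@(mkℚ n e cop)} p∤d eq p∣↧ = p∤d (∣-trans p∣↧ ↧∣d)
      where
      cross : toℚᵘ (ι d) ℚᵘ.* toℚᵘ x ℚᵘ.≃ mkℚᵘ z 0
      cross = ℚᵘₚ.≃-trans (ℚᵘₚ.≃-sym (ℚₚ.toℚᵘ-homo-* (ι d) x))
        (ℚᵘₚ.≃-trans (ℚᵘₚ.≃-reflexive (cong toℚᵘ eq)) (toℚᵘ-/ z 1))

      cross′ : mkℚᵘ (ℤ.+ d) 0 ℚᵘ.* mkℚᵘ n e ℚᵘ.≃ mkℚᵘ z 0
      cross′ = ℚᵘₚ.≃-trans (ℚᵘₚ.*-cong (ℚᵘₚ.≃-sym (toℚᵘ-/ (ℤ.+ d) 1)) ℚᵘₚ.≃-refl) cross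

      product : (ℤ.+ d) ℤ.* n ≡ z ℤ.* (ℤ.+ suc e)
      product with cross′
      ... | *≡* q = trans (sym (ℤₚ.*-identityʳ _)) (trans q (cong (z ℤ.*_) (cong (λ m → ℤ.+ m) (ℕₚ.*-identityˡ (suc e)))))

      ↧∣d : suc e ∣ d
      ↧∣d = coprime-divisor (Coprimality.sym (Coprimality.recompute cop)) (divides ℤ.∣ z ∣ (begin
        ℤ.∣ n ∣ ℕ.* d            ≡⟨ ℕₚ.*-comm ℤ.∣ n ∣ d ⟩
        d ℕ.* ℤ.∣ n ∣            ≡⟨ ℤₚ.abs-* (ℤ.+ d) n ⟨
        ℤ.∣ (ℤ.+ d) ℤ.* n ∣      ≡⟨ cong ℤ.∣_∣ product ⟩
        ℤ.∣ z ℤ.* (ℤ.+ suc e) ∣  ≡⟨ ℤₚ.abs-* z (ℤ.+ suc e) ⟩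
        ℤ.∣ z ∣ ℕ.* suc e        ∎))

  integral-/1 : ∀ z → Integral p (z / 1)
  integral-/1 z = integral 1 z (λ p∣1 → contradiction (∣1⇒≡1 p∣1) λ where refl → ¬prime[1] pr)
    (trans (cong (_* (z / 1)) (sym (fromNat≡ι 1))) (ℚₚ.*-identityˡ (z / 1)))

  integral-+ : ∀ {x y} → Integral p x → Integral p y → Integral p (x + y)
  integral-+ {x} {y} ix iy = integral (↧ₙ x ℕ.* ↧ₙ y) (ℤ.+ ↧ₙ y ℤ.* ↥ x ℤ.+ ℤ.+ ↧ₙ x ℤ.* ↥ y) (∤-* ix iy) (begin
    ι (↧ₙ x ℕ.* ↧ₙ y) * (x + y)
      ≡⟨ cong (_* (x + y)) (ι-* (↧ₙ x) (↧ₙ y)) ⟩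
    ι (↧ₙ x) * ι (↧ₙ y) * (x + y)
      ≡⟨ solve 4 (λ d e x y → d :* e :* (x :+ y) := e :* (d :* x) :+ d :* (e :* y)) refl (ι (↧ₙ x)) (ι (↧ₙ y)) x y ⟩
    ι (↧ₙ y) * (ι (↧ₙ x) * x) + ι (↧ₙ x) * (ι (↧ₙ y) * y)
      ≡⟨ cong₂ _+_ (cong₂ _*_ (sym (fromNat≡ι _)) (↧*≡↥ x)) (cong₂ _*_ (sym (fromNat≡ι _)) (↧*≡↥ y)) ⟩
    ((ℤ.+ ↧ₙ y) / 1) * ((↥ x) / 1) + ((ℤ.+ ↧ₙ x) / 1) * ((↥ y) / 1)
      ≡⟨ cong₂ _+_ (/1-* (ℤ.+ ↧ₙ y) (↥ x)) (/1-* (ℤ.+ ↧ₙ x) (↥ y)) ⟨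
    (ℤ.+ ↧ₙ y ℤ.* ↥ x) / 1 + (ℤ.+ ↧ₙ x ℤ.* ↥ y) / 1
      ≡⟨ /1-+ (ℤ.+ ↧ₙ y ℤ.* ↥ x) (ℤ.+ ↧ₙ x ℤ.* ↥ y) ⟨
    (ℤ.+ ↧ₙ y ℤ.* ↥ x ℤ.+ ℤ.+ ↧ₙ x ℤ.* ↥ y) / 1 ∎)

  integral-* : ∀ {x y} → Integral p x → Integral p y → Integral p (x * y)
  integral-* {x} {y} ix iy = integral (↧ₙ x ℕ.* ↧ₙ y) (↥ x ℤ.* ↥ y) (∤-* ix iy) (begin
    ι (↧ₙ x ℕ.* ↧ₙ y) * (x * y)
      ≡⟨ cong (_* (x * y)) (ι-* (↧ₙ x) (↧ₙ y)) ⟩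
    ι (↧ₙ x) * ι (↧ₙ y) * (x * y)
      ≡⟨ solve 4 (λ d e x y → d :* e :* (x :* y) := (d :* x) :* (e :* y)) refl (ι (↧ₙ x)) (ι (↧ₙ y)) x y ⟩
    ι (↧ₙ x) * x * (ι (↧ₙ y) * y)
      ≡⟨ cong₂ _*_ (↧*≡↥ x) (↧*≡↥ y) ⟩
    ((↥ x) / 1) * ((↥ y) / 1)
      ≡⟨ /1-* (↥ x) (↥ y) ⟨
    (↥ x ℤ.* ↥ y) / 1 ∎)

  integral-r : ∀ {k} → suc k < p → Integral p (r k)
  integral-r {k} k<p = integral (suc k) ℤ.1ℤ (<⇒∤ k<p) (ι*r k)

  infix 4 p^_∣_

  -- Divisibility in the ring of p-integral rationals. As the case e = 0 is integrality itself, the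
  -- rules for sums and products handle integrality and congruences alike.
  record p^_∣_ (e : ℕ) (x : ℚ) : Set where
    constructor multiple
    field
      {quotient}        : ℚ
      quotient-integral : Integral p quotient
      equality          : x ≡ ι (p ℕ.^ e) * quotient

  ∣-resp : ∀ {e x y} → x ≡ y → p^ e ∣ x → p^ e ∣ y
  ∣-resp refl d = d

  ∣-ι : ∀ n → p^ 0 ∣ ι n
  ∣-ι n = multiple {quotient = ι n} (subst (Integral p) (fromNat≡ι n) (integral-/1 (ℤ.+ n)))
    (sym (trans (cong (_* ι n) (sym (fromNat≡ι 1))) (ℚₚ.*-identityˡ (ι n))))

  ∣-integral : ∀ {x} → Integral p x → p^ 0 ∣ x
  ∣-integral {x} ix = multiple ix (sym (trans (cong (_* x) (sym (fromNat≡ι 1))) (ℚₚ.*-identityˡ x)))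

  ∣⇒integral : ∀ {x} → p^ 0 ∣ x → Integral p x
  ∣⇒integral (multiple {q} iq eq) = subst (Integral p) (sym (trans eq (trans (cong (_* q) (sym (fromNat≡ι 1))) (ℚₚ.*-identityˡ q)))) iq

  ∣-const : ∀ z → p^ 0 ∣ z / 1
  ∣-const z = ∣-integral (integral-/1 z)

  ∣-+ : ∀ {e x y} → p^ e ∣ x → p^ e ∣ y → p^ e ∣ x + y
  ∣-+ {e} (multiple {q} iq eq) (multiple {q′} iq′ eq′) = multiple (integral-+ {q} {q′} iq iq′)
    (trans (cong₂ _+_ eq eq′) (sym (ℚₚ.*-distribˡ-+ (ι (p ℕ.^ e)) q q′)))

  ∣-* : ∀ {e f x y} → p^ e ∣ x → p^ f ∣ y → p^ (e ℕ.+ f) ∣ x * y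
  ∣-* {e} {f} {x} {y} (multiple {q} iq eq) (multiple {q′} iq′ eq′) = multiple (integral-* {q} {q′} iq iq′) (begin
    x * y                                       ≡⟨ cong₂ _*_ eq eq′ ⟩
    ι (p ℕ.^ e) * q * (ι (p ℕ.^ f) * q′)        ≡⟨ solve 4 (λ m q n q′ → m :* q :* (n :* q′) := m :* n :* (q :* q′)) refl (ι (p ℕ.^ e)) q (ι (p ℕ.^ f)) q′ ⟩
    ι (p ℕ.^ e) * ι (p ℕ.^ f) * (q * q′)        ≡⟨ cong (_* (q * q′)) (trans (cong ι (ℕₚ.^-distribˡ-+-* p e f)) (ι-* (p ℕ.^ e) (p ℕ.^ f))) ⟨
    ι (p ℕ.^ (e ℕ.+ f)) * (q * q′)              ∎)

  ∣-neg : ∀ {e x} → p^ e ∣ x → p^ e ∣ - x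
  ∣-neg {e} {x} d = ∣-resp (solve 1 (λ x → con (- 1ℚ) :* x := :- x) refl x) (∣-* (∣-const ℤ.-1ℤ) d)

  ∣-- : ∀ {e x y} → p^ e ∣ x → p^ e ∣ y → p^ e ∣ x - y
  ∣-- d d′ = ∣-+ d (∣-neg d′)

  ∣-0 : ∀ {e} → p^ e ∣ 0ℚ
  ∣-0 {e} = multiple (integral-/1 ℤ.0ℤ) (sym (ℚₚ.*-zeroʳ (ι (p ℕ.^ e))))

  ∣-π : p^ 1 ∣ π
  ∣-π = multiple {quotient = 1ℚ} (integral-/1 ℤ.1ℤ) (sym (trans (ℚₚ.*-identityʳ _) (cong ι (ℕₚ.^-identityʳ p))))

  ∣-^ : ∀ e → p^ e ∣ ι (p ℕ.^ e)
  ∣-^ e = multiple {quotient = 1ℚ} (integral-/1 ℤ.1ℤ) (sym (ℚₚ.*-identityʳ _))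

  ∣-r : ∀ {k} → suc k < p → p^ 0 ∣ r k
  ∣-r k<p = ∣-integral {r _} (integral-r k<p)

  ∣-weaken : ∀ {e x} → p^ suc e ∣ x → p^ e ∣ x
  ∣-weaken {e} {x} (multiple {q} iq eq) = multiple (integral-* {π} {q} (∣⇒integral (∣-ι p)) iq) (begin
    x                          ≡⟨ eq ⟩
    ι (p ℕ.* p ℕ.^ e) * q      ≡⟨ cong (_* q) (ι-* p (p ℕ.^ e)) ⟩
    π * ι (p ℕ.^ e) * q        ≡⟨ solve 3 (λ a b c → a :* b :* c := b :* (a :* c)) refl π (ι (p ℕ.^ e)) q ⟩
    ι (p ℕ.^ e) * (π * q)      ∎)

  ∣-cancel-π : ∀ {e x} → p^ suc e ∣ π * x → p^ e ∣ x
  ∣-cancel-π {e} {x} (multiple {q} iq eq) = multiple iq (ι-cancelˡ p (begin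
    π * x                      ≡⟨ eq ⟩
    ι (p ℕ.* p ℕ.^ e) * q      ≡⟨ cong (_* q) (ι-* p (p ℕ.^ e)) ⟩
    π * ι (p ℕ.^ e) * q        ≡⟨ ℚₚ.*-assoc π (ι (p ℕ.^ e)) q ⟩
    π * (ι (p ℕ.^ e) * q)      ∎))

  ∣-cancel-unit : ∀ d {e x} .{{_ : NonZero d}} → ¬ (p ∣ d) → p^ e ∣ ι d * x → p^ e ∣ x
  ∣-cancel-unit (suc d) {e} {x} p∤d div = ∣-resp
    (begin
      r d * (ι (suc d) * x) ≡⟨ solve 3 (λ r d x → r :* (d :* x) := (d :* r) :* x) refl (r d) (ι (suc d)) x ⟩
      ι (suc d) * r d * x   ≡⟨ cong (_* x) (ι*r d) ⟩
      1ℚ * x                ≡⟨ ℚₚ.*-identityˡ x ⟩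
      x                     ∎)
    (∣-* (∣-integral {r d} (integral (suc d) ℤ.1ℤ p∤d (ι*r d))) div)

  ∣-Σ : ∀ n {e f} → (∀ k → k < n → p^ e ∣ f k) → p^ e ∣ Σ< n f
  ∣-Σ zero    {f = f} d = ∣-resp (sym (Σ-zero f)) ∣-0
  ∣-Σ (suc n) {f = f} d = ∣-resp (sym (Σ-last n f)) (∣-+ (∣-Σ n λ k k<n → d k (ℕₚ.m<n⇒m<1+n k<n)) (d n (ℕₚ.n<1+n n)))

  ∣-1 : p^ 0 ∣ 1ℚ
  ∣-1 = ∣-const ℤ.1ℤ

  h-integral : ∀ n → n ≤ N → p^ 0 ∣ h n
  h-integral n n≤N = ∣-Σ n λ k k<n → ∣-r (s≤s (ℕₚ.≤-trans k<n n≤N))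

  h₂-integral : ∀ n → n ≤ N → p^ 0 ∣ h₂ n
  h₂-integral n n≤N = ∣-Σ n λ k k<n → let d = ∣-r (s≤s (ℕₚ.≤-trans k<n n≤N)) in ∣-* d d

  -- Binomial coefficients and powers modulo p

  -- By `c-step` the signed coefficient is the product of 1 - p/j over j ≤ k; each step of the
  -- induction drops only a term p² H_k/(k+1).
  c-sign : ∀ k → k ≤ N → p^ 2 ∣ sign k * c N k - (1ℚ - π * h k)
  c-sign zero    _   = ∣-resp
    (sym (trans (cong₂ (λ x y → 1ℚ * x - (1ℚ - π * y)) (c-zero N) h-zero)
      (solve 1 (λ x → con 1ℚ :* con 1ℚ :- (con 1ℚ :- x :* con 0ℚ) := con 0ℚ) refl π)))
    ∣-0
  c-sign (suc k) k<N = ∣-resp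
    (begin
      (1ℚ - π * r k) * (sign k * c N k - (1ℚ - π * h k)) + π * (π * (r k * h k))
        ≡⟨ solve 5 (λ π r s c h → (con 1ℚ :- π :* r) :* (s :* c :- (con 1ℚ :- π :* h)) :+ π :* (π :* (r :* h))
                    := (:- s) :* ((π :* r :- con 1ℚ) :* c) :- (con 1ℚ :- π :* (h :+ r))) refl π (r k) (sign k) (c N k) (h k) ⟩
      - sign k * ((π * r k - 1ℚ) * c N k) - (1ℚ - π * (h k + r k))
        ≡⟨ cong₂ (λ x y → - sign k * x - (1ℚ - π * y)) (c-step N k) (h-suc k) ⟨
      - sign k * c N (suc k) - (1ℚ - π * h (suc k)) ∎)
    (∣-+ (∣-* (∣-- ∣-1 (∣-* (∣-ι p) r-integral)) (c-sign k k≤N))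
         (∣-* ∣-π (∣-* ∣-π (∣-* r-integral (h-integral k k≤N)))))
    where
    k≤N = ℕₚ.<⇒≤ k<N
    r-integral = ∣-r (s≤s k<N)

  -- Absorption extracts p from the middle coefficients of row p. The cofactor is kept explicit: its
  -- integrality gives Fermat's little theorem, and its value at x = 1 gives the Fermat quotient.
  freshman : ∀ x →
    ι (suc x ℕ.^ p) ≡ 1ℚ + ι (x ℕ.^ p) + π * Σ< N (λ k → c N k * (r k * ι (x ℕ.^ suc k)))
  freshman x = begin
    ι (suc x ℕ.^ p)
      ≡⟨ binomial-theorem x p ⟨
    b
      ≡⟨ solve 1 (λ b → b := con 1ℚ :+ con 1ℚ :* (b :- con 1ℚ)) refl b ⟩
    1ℚ + 1ℚ * (b - 1ℚ)
      ≡⟨ cong₂ (λ y z → 1ℚ + y * (b - z)) (ι*r N) (sym (fromNat≡ι 1)) ⟨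
    1ℚ + π * r N * (b - ι 1)
      ≡⟨ cong (1ℚ +_) (ℚₚ.*-assoc π (r N) _) ⟩
    1ℚ + π * (r N * (b - ι 1))
      ≡⟨ cong (λ z → 1ℚ + π * z) (𝔹-absorption N (λ k → ι (x ℕ.^ k))) ⟨
    1ℚ + π * 𝔹 N (λ k → r k * ι (x ℕ.^ suc k))
      ≡⟨ cong (λ z → 1ℚ + π * z) (𝔹-last N _) ⟩
    1ℚ + π * (s + r N * ι (x ℕ.^ p))
      ≡⟨ solve 4 (λ π s r y → con 1ℚ :+ π :* (s :+ r :* y) := con 1ℚ :+ (π :* r) :* y :+ π :* s) refl π s (r N) (ι (x ℕ.^ p)) ⟩
    1ℚ + π * r N * ι (x ℕ.^ p) + π * s
      ≡⟨ cong (λ z → 1ℚ + z * ι (x ℕ.^ p) + π * s) (ι*r N) ⟩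
    1ℚ + 1ℚ * ι (x ℕ.^ p) + π * s
      ≡⟨ cong (λ z → 1ℚ + z + π * s) (ℚₚ.*-identityˡ (ι (x ℕ.^ p))) ⟩
    1ℚ + ι (x ℕ.^ p) + π * s ∎
    where
    b = 𝔹 p (λ k → ι (x ℕ.^ k))
    s = Σ< N (λ k → c N k * (r k * ι (x ℕ.^ suc k)))

  c-integral : ∀ n k → p^ 0 ∣ c n k
  c-integral n k = ∣-resp (sym (c≡ι n k)) (∣-ι _)

  fermat : ∀ x → p^ 1 ∣ ι (x ℕ.^ p) - ι x
  fermat zero    = ∣-resp (sym (ℚₚ.+-inverseʳ (ι 0))) ∣-0
  fermat (suc x) = ∣-resp
    (begin
      (ι (x ℕ.^ p) - ι x) + π * s
        ≡⟨ solve 3 (λ a b c → (a :- b) :+ c := con 1ℚ :+ a :+ c :- (con 1ℚ :+ b)) refl (ι (x ℕ.^ p)) (ι x) (π * s) ⟩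
      1ℚ + ι (x ℕ.^ p) + π * s - (1ℚ + ι x)
        ≡⟨ cong₂ _-_ (freshman x) (ι-suc x) ⟨
      ι (suc x ℕ.^ p) - ι (suc x) ∎)
    (∣-+ (fermat x) (∣-* ∣-π (∣-Σ N λ k k<N → ∣-* (c-integral N k) (∣-* (∣-r (s≤s k<N)) (∣-ι _)))))
    where s = Σ< N (λ k → c N k * (r k * ι (x ℕ.^ suc k)))

  fermat-unit : ∀ k → k < N → p^ 1 ∣ ι (suc k ℕ.^ N) - 1ℚ
  fermat-unit k k<N = ∣-cancel-unit (suc k) (<⇒∤ (s≤s k<N)) (∣-resp
    (begin
      ι (suc k ℕ.* suc k ℕ.^ N) - ι (suc k)
        ≡⟨ cong (_- ι (suc k)) (ι-* (suc k) (suc k ℕ.^ N)) ⟩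
      ι (suc k) * ι (suc k ℕ.^ N) - ι (suc k)
        ≡⟨ solve 2 (λ x y → x :* y :- x := x :* (y :- con 1ℚ)) refl (ι (suc k)) (ι (suc k ℕ.^ N)) ⟩
      ι (suc k) * (ι (suc k ℕ.^ N) - 1ℚ) ∎)
    (fermat (suc k)))

  inverse-square : ∀ e → N ≡ suc (suc e) → ∀ k → k < N → p^ 1 ∣ ι (suc k ℕ.^ e) - r k * r k
  inverse-square e refl k k<N = ∣-resp
    (begin
      r k * r k * (ι (suc k ℕ.* (suc k ℕ.* suc k ℕ.^ e)) - 1ℚ)
        ≡⟨ cong (λ z → r k * r k * (z - 1ℚ)) (trans (ι-* (suc k) _) (cong (κ *_) (ι-* (suc k) _))) ⟩
      r k * r k * (κ * (κ * y) - 1ℚ)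
        ≡⟨ solve 3 (λ r κ y → r :* r :* (κ :* (κ :* y) :- con 1ℚ) := (κ :* r) :* (κ :* r) :* y :- r :* r) refl (r k) κ y ⟩
      κ * r k * (κ * r k) * y - r k * r k
        ≡⟨ cong (λ z → z * z * y - r k * r k) (ι*r k) ⟩
      1ℚ * 1ℚ * y - r k * r k
        ≡⟨ cong (_- r k * r k) (ℚₚ.*-identityˡ y) ⟩
      y - r k * r k ∎)
    (∣-* (∣-* (∣-r (s≤s k<N)) (∣-r (s≤s k<N))) (fermat-unit k k<N))
    where
    κ = ι (suc k)
    y = ι (suc k ℕ.^ e)

  -- Reflection x ↦ p - x and harmonic numbers at p - 1

  reflect-< : ∀ {k} → k < N → N ∸ suc k < N
  reflect-< {k} k<N = subst (_≤ N) (ℕₚ.+-∸-assoc 1 k<N) (ℕₚ.m∸n≤m N k)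

  -- With x = k + 1 this is 1/x + 1/(p-x) = p/(x(p-x)); the index `N ∸ suc k` stands for p - x.
  r-reflect : ∀ k → k < N → r k + r (N ∸ suc k) ≡ π * (r k * r (N ∸ suc k))
  r-reflect k k<N = begin
    r k + r k′
      ≡⟨ solve 2 (λ r r′ → r :+ r′ := con 1ℚ :* r :+ r′ :* con 1ℚ) refl (r k) (r k′) ⟩
    1ℚ * r k + r k′ * 1ℚ
      ≡⟨ cong₂ (λ x y → x * r k + r k′ * y) (ι*r k′) (ι*r k) ⟨
    ι (suc k′) * r k′ * r k + r k′ * (ι (suc k) * r k)
      ≡⟨ solve 4 (λ κ κ′ r r′ → κ′ :* r′ :* r :+ r′ :* (κ :* r) := (κ :+ κ′) :* (r :* r′)) refl (ι (suc k)) (ι (suc k′)) (r k) (r k′) ⟩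
    (ι (suc k) + ι (suc k′)) * (r k * r k′)
      ≡⟨ cong (_* (r k * r k′)) (trans (cong ι (trans (cong suc (sym (ℕₚ.m+[n∸m]≡n k<N))) (sym (ℕₚ.+-suc (suc k) k′)))) (ι-+ (suc k) (suc k′))) ⟨
    π * (r k * r k′) ∎
    where k′ = N ∸ suc k

  -- The terms removed from the top of `h N` are 1/(p-j) ≡ -1/j for j ≤ k, and `h N` itself vanishes
  -- modulo p.
  h-reflect : ∀ k → k ≤ N → p^ 1 ∣ h N → p^ 1 ∣ h (N ∸ k) - h k
  h-reflect zero    _   d = ∣-resp (sym (trans (cong (λ z → h N - z) h-zero) (solve 1 (λ x → x :- con 0ℚ := x) refl (h N)))) d
  h-reflect (suc k) k<N d = ∣-resp
    (begin
      h (N ∸ k) - h k - π * (r k * r k′)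
        ≡⟨ cong₂ (λ x y → x - h k - y) (trans (cong h (ℕₚ.+-∸-assoc 1 k<N)) (h-suc k′)) (sym (r-reflect k k<N)) ⟩
      h k′ + r k′ - h k - (r k + r k′)
        ≡⟨ solve 4 (λ h′ r′ h r → h′ :+ r′ :- h :- (r :+ r′) := h′ :- (h :+ r)) refl (h k′) (r k′) (h k) (r k) ⟩
      h k′ - (h k + r k)
        ≡⟨ cong (λ z → h k′ - z) (h-suc k) ⟨
      h k′ - h (suc k) ∎)
    (∣-- (h-reflect k (ℕₚ.<⇒≤ k<N) d) (∣-* ∣-π (∣-* (∣-r (s≤s k<N)) (∣-r (s≤s (reflect-< k<N))))))
    where k′ = N ∸ suc k

  2h : 2ℚ * h N ≡ π * Σ< N (λ k → r k * r (N ∸ suc k))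
  2h = begin
    2ℚ * h N
      ≡⟨ solve 1 (λ x → con 2ℚ :* x := x :+ x) refl (h N) ⟩
    h N + h N
      ≡⟨ cong (h N +_) (Σ-reverse N r) ⟩
    h N + Σ< N (λ k → r (N ∸ suc k))
      ≡⟨ Σ-+ N r _ ⟨
    Σ< N (λ k → r k + r (N ∸ suc k))
      ≡⟨ Σ-cong< N r-reflect ⟩
    Σ< N (λ k → π * (r k * r (N ∸ suc k)))
      ≡⟨ Σ-*ˡ N π _ ⟩
    π * Σ< N (λ k → r k * r (N ∸ suc k)) ∎

  cancel-2 : ∀ {e x} → ¬ (p ∣ 2) → p^ e ∣ 2ℚ * x → p^ e ∣ x
  cancel-2 {x = x} p∤2 d = ∣-cancel-unit 2 p∤2 (∣-resp (cong (_* x) (fromNat≡ι 2)) d)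

  p∣h : ¬ (p ∣ 2) → p^ 1 ∣ h N
  p∣h p∤2 = cancel-2 p∤2 (∣-resp (sym 2h)
    (∣-* ∣-π (∣-Σ N λ k k<N → ∣-* (∣-r (s≤s k<N)) (∣-r (s≤s (reflect-< k<N))))))

  -- One factor p is explicit in `2h`. As 1/(p-x) ≡ -1/x, the remaining sum is congruent to
  -- `- h₂ N`, which supplies the second.
  p²∣h : ¬ (p ∣ 2) → p^ 1 ∣ h₂ N → p^ 2 ∣ h N
  p²∣h p∤2 d = cancel-2 p∤2 (∣-resp (sym 2h) (∣-* ∣-π (∣-resp
    (begin
      Σ< N (λ k → r k * (π * (r k * r (N ∸ suc k)))) - h₂ N
        ≡⟨ Σ-- N _ _ ⟨
      Σ< N (λ k → r k * (π * (r k * r (N ∸ suc k))) - r k * r k)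
        ≡⟨ Σ-cong< N (λ k k<N → trans (cong (λ z → r k * z - r k * r k) (sym (r-reflect k k<N)))
             (solve 2 (λ x y → x :* (x :+ y) :- x :* x := x :* y) refl (r k) (r (N ∸ suc k)))) ⟩
      Σ< N (λ k → r k * r (N ∸ suc k)) ∎)
    (∣-- (∣-Σ N λ k k<N → let i = ∣-r (s≤s k<N) in
                          ∣-* i (∣-* ∣-π (∣-* i (∣-r (s≤s (reflect-< k<N)))))) d))))

  -- Bernoulli numbers and power sums modulo p²

  -- Forward substitution: the diagonal coefficient of row m is C(m+1, m) = m + 1, a unit because m
  -- + 1 < p.
  triangular : ∀ {e} (X : ℕ → ℚ) → (∀ m → m < N → p^ e ∣ Σ< (suc m) (λ j → c (suc m) j * X j)) →
               ∀ n → n ≤ N → ∀ j → j < n → p^ e ∣ X j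
  triangular X div (suc n) n<N j j<1+n with ℕₚ.m≤n⇒m<n∨m≡n (ℕₚ.≤-pred j<1+n)
  ... | inj₁ j<n  = triangular X div n (ℕₚ.<⇒≤ n<N) j j<n
  ... | inj₂ refl = ∣-cancel-unit (suc n) (<⇒∤ (s≤s n<N)) (∣-resp
    (begin
      Σ< (suc n) (λ j → c (suc n) j * X j) - s
        ≡⟨ cong (_- s) (Σ-last n _) ⟩
      s + c (suc n) n * X n - s
        ≡⟨ solve 2 (λ x y → x :+ y :- x := y) refl s (c (suc n) n * X n) ⟩
      c (suc n) n * X n
        ≡⟨ cong (_* X n) (c-subdiagonal n) ⟩
      ι (suc n) * X n ∎)
    (∣-- (div n n<N) (∣-Σ n λ j j<n → ∣-* (c-integral (suc n) j) (triangular X div n (ℕₚ.<⇒≤ n<N) j j<n))))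
    where s = Σ< n (λ j → c (suc n) j * X j)

  -- The elementary range j ≤ p - 2 of the von Staudt-Clausen theorem.
  B-integral : ∀ j → j < N → p^ 0 ∣ B j
  B-integral = triangular B rec N ℕₚ.≤-refl
    where
    rec : ∀ m → m < N → p^ 0 ∣ Σ< (suc m) (λ j → c (suc m) j * B j)
    rec zero    _ = ∣-resp (sym B-zero) ∣-1
    rec (suc m) _ = ∣-resp (sym (B-recurrence m)) ∣-0

  -- The term k = 0 belongs to the sum, so that 0^0 = 1 makes `S 0` equal to p = p B_0.
  S : ℕ → ℚ
  S j = Σ< p (λ k → ι (k ℕ.^ j))

  -- Row m of the system has right-hand side p^(m+1) for `S` and p times that of the Bernoulli
  -- recurrence for `π * B`. These cancel for m = 0, and for m ≥ 1 the difference p^(m+1) is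
  -- divisible by p².
  S≡πB : ∀ j → j < N → p^ 2 ∣ S j - π * B j
  S≡πB = triangular (λ j → S j - π * B j) rec N ℕₚ.≤-refl
    where
    expand : ∀ m → Σ< (suc m) (λ j → c (suc m) j * (S j - π * B j))
               ≡ ι (p ℕ.^ suc m) - π * Σ< (suc m) (λ j → c (suc m) j * B j)
    expand m = begin
      Σ< (suc m) (λ j → c (suc m) j * (S j - π * B j))
        ≡⟨ Σ-cong (suc m) (λ j → solve 4 (λ c s π b → c :* (s :- π :* b) := c :* s :- π :* (c :* b)) refl (c (suc m) j) (S j) π (B j)) ⟩
      Σ< (suc m) (λ j → c (suc m) j * S j - π * (c (suc m) j * B j))
        ≡⟨ Σ-- (suc m) _ _ ⟩
      Σ< (suc m) (λ j → c (suc m) j * S j) - Σ< (suc m) (λ j → π * (c (suc m) j * B j))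
        ≡⟨ cong₂ _-_ (power-sum-recurrence m p) (Σ-*ˡ (suc m) π _) ⟩
      ι (p ℕ.^ suc m) - π * Σ< (suc m) (λ j → c (suc m) j * B j) ∎

    rec : ∀ m → m < N → p^ 2 ∣ Σ< (suc m) (λ j → c (suc m) j * (S j - π * B j))
    rec zero    _ = ∣-resp (sym (begin
      Σ< 1 (λ j → c 1 j * (S j - π * B j))            ≡⟨ expand 0 ⟩
      ι (p ℕ.^ 1) - π * Σ< 1 (λ j → c 1 j * B j)      ≡⟨ cong₂ (λ x y → ι x - π * y) (ℕₚ.^-identityʳ p) B-zero ⟩
      π - π * 1ℚ                                      ≡⟨ solve 1 (λ x → x :- x :* con 1ℚ := con 0ℚ) refl π ⟩
      0ℚ                                              ∎)) ∣-0
    rec (suc m) _ = ∣-resp (sym (begin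
      Σ< (suc (suc m)) (λ j → c (suc (suc m)) j * (S j - π * B j))
        ≡⟨ expand (suc m) ⟩
      ι (p ℕ.^ suc (suc m)) - π * Σ< (suc (suc m)) (λ j → c (suc (suc m)) j * B j)
        ≡⟨ cong₂ (λ x y → x - π * y) (trans (cong ι (ℕₚ.^-distribˡ-+-* p 2 m)) (ι-* (p ℕ.^ 2) (p ℕ.^ m))) (B-recurrence m) ⟩
      ι (p ℕ.^ 2) * ι (p ℕ.^ m) - π * 0ℚ
        ≡⟨ solve 2 (λ x y → x :- y :* con 0ℚ := x) refl (ι (p ℕ.^ 2) * ι (p ℕ.^ m)) π ⟩
      ι (p ℕ.^ 2) * ι (p ℕ.^ m) ∎))
      (∣-* (∣-^ 2) (∣-ι _))

-- Parity and the alternating harmonic sum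

sign-even : ∀ k → sign (k ℕ.+ k) ≡ 1ℚ
sign-even zero    = refl
sign-even (suc k) = begin
  - sign (k ℕ.+ suc k)    ≡⟨ cong (λ m → - sign m) (ℕₚ.+-suc k k) ⟩
  - (- sign (k ℕ.+ k))    ≡⟨ cong (λ z → - (- z)) (sign-even k) ⟩
  1ℚ                      ∎

sign² : ∀ k → sign k * sign k ≡ 1ℚ
sign² zero    = refl
sign² (suc k) = trans (solve 1 (λ s → (:- s) :* (:- s) := s :* s) refl (sign k)) (sign² k)

ι-even : ∀ k → ι (suc (suc (k ℕ.+ k))) ≡ 2ℚ * ι (suc k)
ι-even k = trans (cong (ι ∘ suc) (sym (ℕₚ.+-suc k k))) (ι-double (suc k))

r-double : ∀ k → r k ≡ 2ℚ * r (suc (k ℕ.+ k))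
r-double k = ι-cancelˡ (suc k) (begin
  ι (suc k) * r k                               ≡⟨ trans (ι*r k) (sym (ι*r (suc (k ℕ.+ k)))) ⟩
  ι (suc (suc (k ℕ.+ k))) * r (suc (k ℕ.+ k))   ≡⟨ cong (_* r (suc (k ℕ.+ k))) (ι-even k) ⟩
  2ℚ * ι (suc k) * r (suc (k ℕ.+ k))            ≡⟨ solve 2 (λ x r → con 2ℚ :* x :* r := x :* (con 2ℚ :* r)) refl (ι (suc k)) (r (suc (k ℕ.+ k))) ⟩
  ι (suc k) * (2ℚ * r (suc (k ℕ.+ k)))          ∎)

-- With all signs made positive, the reciprocals of the even integers have to be subtracted twice,
-- and 2/(2j) = 1/j.
alternating-harmonic : ∀ n → Σ< (n ℕ.+ n) (λ k → sign k * r k) ≡ h (n ℕ.+ n) - h n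
alternating-harmonic n = begin
  Σ< (n ℕ.+ n) (λ k → sign k * r k)
    ≡⟨ Σ-parity n _ ⟩
  Σ< n (λ k → sign (k ℕ.+ k) * x k + - sign (k ℕ.+ k) * y k)
    ≡⟨ Σ-cong n (λ k → trans (cong (λ s → s * x k + - s * y k) (sign-even k))
         (solve 2 (λ x y → con 1ℚ :* x :+ (:- con 1ℚ) :* y := (x :+ y) :- con 2ℚ :* y) refl (x k) (y k))) ⟩
  Σ< n (λ k → (x k + y k) - 2ℚ * y k)
    ≡⟨ Σ-- n _ _ ⟩
  Σ< n (λ k → x k + y k) - Σ< n (λ k → 2ℚ * y k)
    ≡⟨ cong₂ _-_ (Σ-parity n r) (Σ-cong n r-double) ⟨
  h (n ℕ.+ n) - h n ∎
  where
  x y : ℕ → ℚ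
  x k = r (k ℕ.+ k)
  y k = r (suc (k ℕ.+ k))

-- A record rather than a product, so that instances are compared by their
-- parameters, without unfolding the sums.
record Congruences (p p-1 half p-3 : ℕ) (q : ℚ) : Set where
  field
    congruence₁ : 3 < p → ∑[1≤ k ≤ p-1 ] centralBinom/4^ k * H k ⟨ 1 ⟩
      ≡ fromNat 2 - fromNat 2 * fromNat p + fromNat 4 * fromNat (p ℕ.^ 2) * q [mod p ^ 3 ]
    congruence₂ : ∑[0≤ k ≤ half ] centralBinom/4^ k * H k ⟨ 2 ⟩ ≡ - (fromNat 4 * q) [mod p ^ 1 ]
    congruence₃ : ∑[1≤ k ≤ half ] centralBinom/k4^ k * H k ⟨ 2 ⟩ ≡ bernoulli p-3 * ½ [mod p ^ 1 ]

open Congruences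

-- Here p = 2m + 3: the exponent p - 3 = m + m is visibly even, and p > 3 reads `0 < m`.
module AtOddPrime (m : ℕ) (pr : Prime (suc (suc m ℕ.+ suc m))) where
  n N e : ℕ
  n = suc m
  N = n ℕ.+ n
  e = m ℕ.+ m

  open AtPrime N pr

  N≡2+e : N ≡ suc (suc e)
  N≡2+e = cong suc (ℕₚ.+-suc m m)

  2<p : 2 < p
  2<p = subst (λ k → 2 < suc k) (sym N≡2+e) (s≤s (s≤s (s≤s z≤n)))

  p∤2 : ¬ (p ∣ 2)
  p∤2 = <⇒∤ 2<p

  <n⇒<N : ∀ {k} → k < n → k < N
  <n⇒<N k<n = ℕₚ.m≤n⇒m≤n+o n k<n

  n≤N : n ≤ N
  n≤N = ℕₚ.m≤m+n n n

  e<N : e < N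
  e<N = subst (e <_) (sym N≡2+e) (ℕₚ.m<n⇒m<1+n (ℕₚ.n<1+n e))

  π≡ : π ≡ 1ℚ + 2ℚ * ι n
  π≡ = ι-odd n

  -- The Fermat quotient of 2 and the sum with H_k^(2)

  q : ℚ
  q = fermatQuotient p 2 {{prime⇒nonZero pr}}

  π*q : π * q ≡ ι (2 ℕ.^ N) - 1ℚ
  π*q = begin
    π * q                                   ≡⟨ ι*/ (ℤ.+ (2 ℕ.^ N) ℤ.- ℤ.1ℤ) p {{prime⇒nonZero pr}} ⟩
    (ℤ.+ (2 ℕ.^ N) ℤ.- ℤ.1ℤ) / 1            ≡⟨ /1-+ (ℤ.+ (2 ℕ.^ N)) (ℤ.- ℤ.1ℤ) ⟩
    fromNat (2 ℕ.^ N) - 1ℚ                  ≡⟨ cong (_- 1ℚ) (fromNat≡ι (2 ℕ.^ N)) ⟩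
    ι (2 ℕ.^ N) - 1ℚ                        ∎

  -- Both sides times p are 2^p - 2, the right one by `freshman` at x = 1. Exactness of the identity
  -- also yields the integrality of `q`.
  2q : 2ℚ * q ≡ Σ< N (λ k → c N k * r k)
  2q = ι-cancelˡ p (begin
    π * (2ℚ * q)
      ≡⟨ solve 2 (λ π q → π :* (con 2ℚ :* q) := con 2ℚ :* (π :* q)) refl π q ⟩
    2ℚ * (π * q)
      ≡⟨ cong (2ℚ *_) π*q ⟩
    2ℚ * (ι (2 ℕ.^ N) - 1ℚ)
      ≡⟨ solve 1 (λ x → con 2ℚ :* (x :- con 1ℚ) := con 2ℚ :* x :- con 1ℚ :- con 1ℚ) refl (ι (2 ℕ.^ N)) ⟩
    2ℚ * ι (2 ℕ.^ N) - 1ℚ - 1ℚ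
      ≡⟨ cong (λ z → z * ι (2 ℕ.^ N) - 1ℚ - 1ℚ) (fromNat≡ι 2) ⟩
    ι 2 * ι (2 ℕ.^ N) - 1ℚ - 1ℚ
      ≡⟨ cong (λ z → z - 1ℚ - 1ℚ) (trans (sym (ι-* 2 (2 ℕ.^ N))) (freshman 1)) ⟩
    1ℚ + ι (1 ℕ.^ p) + π * Σ< N (λ k → c N k * (r k * ι (1 ℕ.^ suc k))) - 1ℚ - 1ℚ
      ≡⟨ cong₂ (λ x y → 1ℚ + x + π * y - 1ℚ - 1ℚ) (ι1^ p)
           (Σ-cong N λ k → cong (c N k *_) (trans (cong (r k *_) (ι1^ (suc k))) (ℚₚ.*-identityʳ (r k)))) ⟩
    1ℚ + 1ℚ + π * s - 1ℚ - 1ℚ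
      ≡⟨ solve 1 (λ x → con 1ℚ :+ con 1ℚ :+ x :- con 1ℚ :- con 1ℚ := x) refl (π * s) ⟩
    π * s ∎)
    where
    s = Σ< N (λ k → c N k * r k)

    ι1^ : ∀ k → ι (1 ℕ.^ k) ≡ 1ℚ
    ι1^ k = trans (cong ι (ℕₚ.^-zeroˡ k)) (sym (fromNat≡ι 1))

  q-integral : p^ 0 ∣ q
  q-integral = cancel-2 p∤2 (∣-resp (sym 2q) (∣-Σ N λ k k<N → ∣-* (c-integral N k) (∣-r (s≤s k<N))))

  sign-integral : ∀ k → p^ 0 ∣ sign k
  sign-integral zero    = ∣-1
  sign-integral (suc k) = ∣-neg (sign-integral k)

  -- Modulo p, `c-sign` turns the sum in `2q` into the alternating harmonic sum `h N - h n`, where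
  -- `h N` vanishes.
  p∣2q+h : p^ 1 ∣ 2ℚ * q + h n
  p∣2q+h = ∣-resp
    (begin
      Σ< N (λ k → c N k * r k - sign k * r k) + h N
        ≡⟨ cong (_+ h N) (trans (Σ-- N _ _) (cong₂ _-_ (sym 2q) (alternating-harmonic n))) ⟩
      2ℚ * q - (h N - h n) + h N
        ≡⟨ solve 3 (λ x y z → x :- (y :- z) :+ y := x :+ z) refl (2ℚ * q) (h N) (h n) ⟩
      2ℚ * q + h n ∎)
    (∣-+ (∣-Σ N λ k k<N → ∣-resp (eq k)
            (∣-* (∣-* (sign-integral k) (∣-- (∣-weaken (c-sign k (ℕₚ.<⇒≤ k<N))) (∣-* ∣-π (h-integral k (ℕₚ.<⇒≤ k<N)))))
                 (∣-r (s≤s k<N))))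
         (p∣h p∤2))
    where
    eq : ∀ k → sign k * (sign k * c N k - (1ℚ - π * h k) - π * h k) * r k ≡ c N k * r k - sign k * r k
    eq k = begin
      sign k * (sign k * c N k - (1ℚ - π * h k) - π * h k) * r k
        ≡⟨ solve 4 (λ s c x r → s :* (s :* c :- (con 1ℚ :- x) :- x) :* r := (s :* s) :* (c :* r) :- s :* r) refl (sign k) (c N k) (π * h k) (r k) ⟩
      sign k * sign k * (c N k * r k) - sign k * r k
        ≡⟨ cong (λ z → z * (c N k * r k) - sign k * r k) (sign² k) ⟩
      1ℚ * (c N k * r k) - sign k * r k
        ≡⟨ cong (_- sign k * r k) (ℚₚ.*-identityˡ (c N k * r k)) ⟩
      c N k * r k - sign k * r k ∎

  -- C(2k,k)/4^k = (-1)^k C(-1/2,k), and n ≡ -1/2.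
  a≡sign*c : ∀ k → k ≤ n → p^ 1 ∣ a k - sign k * c n k
  a≡sign*c zero    _   = ∣-resp (sym (trans (cong₂ (λ x y → x - 1ℚ * y) (sym (a≡ 0)) (c-zero n)) refl)) ∣-0
  a≡sign*c (suc k) k<n = ∣-cancel-unit (suc k) (<⇒∤ (s≤s (<n⇒<N k<n))) (cancel-2 p∤2 (∣-resp
    (begin
      (1ℚ + 2ℚ * ι k) * (a k - x) + π * x
        ≡⟨ cong (λ z → (1ℚ + 2ℚ * ι k) * (a k - x) + z * x) π≡ ⟩
      (1ℚ + 2ℚ * ι k) * (a k - x) + (1ℚ + 2ℚ * ι n) * x
        ≡⟨ solve 4 (λ k a x n → (con 1ℚ :+ con 2ℚ :* k) :* (a :- x) :+ (con 1ℚ :+ con 2ℚ :* n) :* x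
                    := (con 1ℚ :+ con 2ℚ :* k) :* a :- con 2ℚ :* (((con 1ℚ :+ k) :- (con 1ℚ :+ n) :* con 1ℚ) :* x)) refl (ι k) (a k) x (ι n) ⟩
      (1ℚ + 2ℚ * ι k) * a k - 2ℚ * (((1ℚ + ι k) - (1ℚ + ι n) * 1ℚ) * x)
        ≡⟨ cong₂ _-_ (a-suc k) (cong (λ z → 2ℚ * (z * x)) (cong₂ _-_ (ι-suc k) (cong₂ _*_ (ι-suc n) (ι*r k)))) ⟨
      2ℚ * (κ * a (suc k)) - 2ℚ * ((κ - ι (suc n) * (κ * r k)) * x)
        ≡⟨ solve 6 (λ κ a ν r s c → con 2ℚ :* (κ :* a) :- con 2ℚ :* ((κ :- ν :* (κ :* r)) :* (s :* c))
                    := con 2ℚ :* (κ :* (a :- (:- s) :* ((ν :* r :- con 1ℚ) :* c)))) refl κ (a (suc k)) (ι (suc n)) (r k) (sign k) (c n k) ⟩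
      2ℚ * (κ * (a (suc k) - (- sign k) * ((ι (suc n) * r k - 1ℚ) * c n k)))
        ≡⟨ cong (λ z → 2ℚ * (κ * (a (suc k) - (- sign k) * z))) (c-step n k) ⟨
      2ℚ * (κ * (a (suc k) - sign (suc k) * c n (suc k))) ∎)
    (∣-+ (∣-* (∣-+ ∣-1 (∣-* (∣-const (ℤ.+ 2)) (∣-ι k))) (a≡sign*c k (ℕₚ.<⇒≤ k<n)))
         (∣-* ∣-π (∣-* (sign-integral k) (c-integral n k))))))
    where
    κ = ι (suc k)
    x = sign k * c n k

  a-integral : ∀ k → k ≤ n → p^ 0 ∣ a k
  a-integral k k≤n = ∣-resp (solve 2 (λ a x → a :- x :+ x := a) refl (a k) (sign k * c n k))
    (∣-+ (∣-weaken (a≡sign*c k k≤n)) (∣-* (sign-integral k) (c-integral n k)))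

  -- Termwise `a≡sign*c`. The value `f 0` has to vanish because the difference starts at k = 0 and
  -- the sum at k = 1.
  Σ-a≡Δ : ∀ f → (∀ k → k < n → p^ 0 ∣ f (suc k)) → f 0 ≡ 0ℚ →
          p^ 1 ∣ Σ< n (λ k → a (suc k) * f (suc k)) - Δ n f
  Σ-a≡Δ f int f0 = ∣-resp
    (begin
      Σ< n (λ k → (a (suc k) - sign (suc k) * c n (suc k)) * f (suc k))
        ≡⟨ trans (Σ-cong n λ k → solve 4 (λ a s c x → (a :- s :* c) :* x := a :* x :- c :* (s :* x)) refl (a (suc k)) (sign (suc k)) (c n (suc k)) (f (suc k))) (Σ-- n _ _) ⟩
      Σ< n (λ k → a (suc k) * f (suc k)) - s
        ≡⟨ cong (λ z → Σ< n (λ k → a (suc k) * f (suc k)) - z) (sym (begin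
             Δ n f                             ≡⟨ Σ-head n _ ⟩
             c n 0 * (1ℚ * f 0) + s            ≡⟨ cong (λ z → c n 0 * (1ℚ * z) + s) f0 ⟩
             c n 0 * (1ℚ * 0ℚ) + s             ≡⟨ solve 2 (λ c s → c :* (con 1ℚ :* con 0ℚ) :+ s := s) refl (c n 0) s ⟩
             s                                 ∎)) ⟩
      Σ< n (λ k → a (suc k) * f (suc k)) - Δ n f ∎)
    (∣-Σ n λ k k<n → ∣-* (a≡sign*c (suc k) k<n) (int k k<n))
    where s = Σ< n (λ k → c n (suc k) * (sign (suc k) * f (suc k)))

  r-integral : ∀ k → k < n → p^ 0 ∣ r k
  r-integral k k<n = ∣-r (s≤s (<n⇒<N k<n))

  -- The boundary term `G n * h₂ n` of the summation by parts disappears modulo p because its factor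
  -- 2n + 1 is p itself.
  p∣∑a*h₂ : p^ 1 ∣ Σ< (suc n) (λ k → a k * h₂ k) - (- (4ℚ * q))
  p∣∑a*h₂ = ∣-resp
    (begin
      π * (a n * h₂ n) - 2ℚ * (s - Δ n reciprocal) + 2ℚ * (2ℚ * q + h n)
        ≡⟨ cong (λ z → π * (a n * h₂ n) - 2ℚ * (s - z) + 2ℚ * (2ℚ * q + h n)) (Δ-reciprocal n) ⟩
      π * (a n * h₂ n) - 2ℚ * (s - (- h n)) + 2ℚ * (2ℚ * q + h n)
        ≡⟨ solve 6 (λ π a h₂ s h q → π :* (a :* h₂) :- con 2ℚ :* (s :- (:- h)) :+ con 2ℚ :* (con 2ℚ :* q :+ h)
             := π :* a :* h₂ :- con 2ℚ :* s :- (:- (con 4ℚ :* q))) refl π (a n) (h₂ n) s (h n) q ⟩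
      π * a n * h₂ n - 2ℚ * s - (- (4ℚ * q))
        ≡⟨ cong (λ z → z * a n * h₂ n - 2ℚ * s - (- (4ℚ * q))) π≡ ⟩
      G n * h₂ n - 2ℚ * s - (- (4ℚ * q))
        ≡⟨ cong (_- (- (4ℚ * q))) (Σ-a*h₂ n) ⟨
      Σ< n (λ k → a (suc k) * h₂ (suc k)) - (- (4ℚ * q))
        ≡⟨ cong (_- (- (4ℚ * q))) (begin
             t                      ≡⟨ solve 2 (λ t a → t := a :* con 0ℚ :+ t) refl t (a 0) ⟩
             a 0 * 0ℚ + t           ≡⟨ cong (λ z → a 0 * z + t) h₂-zero ⟨
             a 0 * h₂ 0 + t         ≡⟨ Σ-head n _ ⟨
             Σ< (suc n) (λ k → a k * h₂ k) ∎) ⟩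
      Σ< (suc n) (λ k → a k * h₂ k) - (- (4ℚ * q)) ∎)
    (∣-+ (∣-- (∣-* ∣-π (∣-* (a-integral n ℕₚ.≤-refl) (h₂-integral n n≤N)))
              (∣-* (∣-const (ℤ.+ 2)) (Σ-a≡Δ reciprocal r-integral refl)))
         (∣-* (∣-const (ℤ.+ 2)) p∣2q+h))
    where
    s = Σ< n (λ k → a (suc k) * r k)
    t = Σ< n (λ k → a (suc k) * h₂ (suc k))

  -- The sum with H_k^(2)/k and the Bernoulli number

  -- An integer stand-in for 1/(k+1)² modulo p, whose sum over k < p - 1 is accessible modulo p²
  -- through Bernoulli numbers.
  F : ℕ → ℚ
  F k = ι (suc k ℕ.^ e)

  F≡r² : ∀ k → k < N → p^ 1 ∣ F k - r k * r k
  F≡r² = inverse-square e N≡2+e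

  A W X Y : ℚ
  A = Σ< n (λ k → h (suc k) * (r k * r k))
  W = Σ< N (λ k → h (suc k) * (r k * r k))
  X = Σ< n F
  Y = Σ< n (λ k → F k * r k)

  B≡W : p^ 1 ∣ B e - W
  B≡W = ∣-resp (solve 3 (λ b v w → b :- v :+ (v :- w) := b :- w) refl (B e) V W) (∣-+ B≡V V≡W)
    where
    -- `V` is `W` with k^e in place of 1/k²; its extra term k = 0 vanishes through `h 0`, also when
    -- 0^e = 1.
    V = Σ< p (λ k → h k * ι (k ℕ.^ e))

    vanishing : Σ< p (λ k → c N k * (sign k * ι (k ℕ.^ e))) ≡ 0ℚ
    vanishing = begin
      Δ N (λ k → ι (k ℕ.^ e))
        ≡⟨ Δ-cong N (λ k → cong (λ j → ι (j ℕ.^ e)) (sym (ℕₚ.+-identityʳ k))) ⟩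
      Δ N (λ k → ι ((k ℕ.+ 0) ℕ.^ e))
        ≡⟨ cong (λ l → Δ l (λ k → ι ((k ℕ.+ 0) ℕ.^ e))) N≡2+e ⟩
      Δ (suc (suc e)) (λ k → ι ((k ℕ.+ 0) ℕ.^ e))
        ≡⟨ Δ-power (suc e) e 0 (ℕₚ.n≤1+n e) ⟩
      0ℚ ∎

    S≡πV : p^ 2 ∣ S e - π * V
    S≡πV = ∣-resp
      (begin
        - Σ< p (λ k → (sign k * c N k - (1ℚ - π * h k)) * ι (k ℕ.^ e))
          ≡⟨ cong -_ (trans (Σ-cong p λ k → solve 5 (λ s c π h x → (s :* c :- (con 1ℚ :- π :* h)) :* x := c :* (s :* x) :- (x :- π :* (h :* x)))
               refl (sign k) (c N k) π (h k) (ι (k ℕ.^ e))) (Σ-- p _ _)) ⟩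
        - (Σ< p (λ k → c N k * (sign k * ι (k ℕ.^ e))) - Σ< p (λ k → ι (k ℕ.^ e) - π * (h k * ι (k ℕ.^ e))))
          ≡⟨ cong₂ (λ x y → - (x - y)) vanishing (trans (Σ-- p _ _) (cong (λ z → S e - z) (Σ-*ˡ p π _))) ⟩
        - (0ℚ - (S e - π * V))
          ≡⟨ solve 1 (λ x → :- (con 0ℚ :- x) := x) refl (S e - π * V) ⟩
        S e - π * V ∎)
      (∣-neg (∣-Σ p λ k k<p → ∣-* (c-sign k (ℕₚ.≤-pred k<p)) (∣-ι _)))

    B≡V : p^ 1 ∣ B e - V
    B≡V = ∣-cancel-π (∣-resp
      (solve 4 (λ s π b v → (s :- π :* v) :- (s :- π :* b) := π :* (b :- v)) refl (S e) π (B e) V)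
      (∣-- S≡πV (S≡πB e e<N)))

    V≡W : p^ 1 ∣ V - W
    V≡W = ∣-resp
      (begin
        Σ< N (λ k → h (suc k) * (F k - r k * r k))
          ≡⟨ trans (Σ-cong N λ k → solve 3 (λ h f r → h :* (f :- r) := h :* f :- h :* r) refl (h (suc k)) (F k) (r k * r k)) (Σ-- N _ _) ⟩
        V′ - W
          ≡⟨ cong (_- W) (solve 2 (λ v x → v := con 0ℚ :* x :+ v) refl V′ (ι (0 ℕ.^ e))) ⟩
        0ℚ * ι (0 ℕ.^ e) + V′ - W
          ≡⟨ cong (λ z → z * ι (0 ℕ.^ e) + V′ - W) h-zero ⟨
        h 0 * ι (0 ℕ.^ e) + V′ - W
          ≡⟨ cong (_- W) (Σ-head N _) ⟨
        V - W ∎)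
      (∣-Σ N λ k k<N → ∣-* (h-integral (suc k) k<N) (F≡r² k k<N))
      where V′ = Σ< N (λ k → h (suc k) * F k)

  -- The partner of H_x/x² is H_(p-x)/(p-x)² ≡ H_(x-1)/x² = H_x/x² - 1/x³, by `h-reflect` and
  -- `r-reflect`.
  W≡2A-h₃ : p^ 1 ∣ W - (2ℚ * A - h₃ n)
  W≡2A-h₃ = ∣-resp
    (begin
      Σ< n (λ k → (f k + f (N ∸ suc k)) - (2ℚ * f k - r k * (r k * r k)))
        ≡⟨ Σ-- n _ _ ⟩
      Σ< n (λ k → f k + f (N ∸ suc k)) - Σ< n (λ k → 2ℚ * f k - r k * (r k * r k))
        ≡⟨ cong₂ _-_ (sym (Σ-fold n f)) (trans (Σ-- n _ _) (cong (_- h₃ n) (Σ-*ˡ n 2ℚ f))) ⟩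
      W - (2ℚ * A - h₃ n) ∎)
    (∣-Σ n term)
    where
    f : ℕ → ℚ
    f k = h (suc k) * (r k * r k)

    term : ∀ k → k < n → p^ 1 ∣ (f k + f (N ∸ suc k)) - (2ℚ * f k - r k * (r k * r k))
    term k k<n = ∣-resp
      (begin
        (h (N ∸ k) - h k) * (ρ * ρ) + h k * (π * (r k * ρ) * (ρ - r k))
          ≡⟨ cong₂ (λ x y → (h x - h k) * (ρ * ρ) + h k * (y * (ρ - r k)))
               (ℕₚ.+-∸-assoc 1 (<n⇒<N k<n)) (sym (r-reflect k (<n⇒<N k<n))) ⟩
        (η - h k) * (ρ * ρ) + h k * ((r k + ρ) * (ρ - r k))
          ≡⟨ solve 4 (λ η h r ρ → (η :- h) :* (ρ :* ρ) :+ h :* ((r :+ ρ) :* (ρ :- r))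
               := (h :+ r) :* (r :* r) :+ η :* (ρ :* ρ) :- (con 2ℚ :* ((h :+ r) :* (r :* r)) :- r :* (r :* r))) refl η (h k) (r k) ρ ⟩
        (h k + r k) * (r k * r k) + η * (ρ * ρ) - (2ℚ * ((h k + r k) * (r k * r k)) - r k * (r k * r k))
          ≡⟨ cong (λ z → z * (r k * r k) + η * (ρ * ρ) - (2ℚ * (z * (r k * r k)) - r k * (r k * r k))) (h-suc k) ⟨
        (f k + f (N ∸ suc k)) - (2ℚ * f k - r k * (r k * r k)) ∎)
      (∣-+ (∣-* (h-reflect k k≤N (p∣h p∤2)) (∣-* ρ-int ρ-int))
           (∣-* (h-integral k k≤N) (∣-* (∣-* ∣-π (∣-* (r-integral k k<n) ρ-int)) (∣-- ρ-int (r-integral k k<n)))))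
      where
      ρ = r (N ∸ suc k)
      η = h (suc (N ∸ suc k))
      k≤N = ℕₚ.<⇒≤ (<n⇒<N k<n)
      ρ-int = ∣-r (s≤s (reflect-< (<n⇒<N k<n)))

  -- (p-x)^i ≡ (-x)^i (1 - i p/x) (mod p²) for x = j+1.
  reflect-power : ∀ j j′ → suc j ℕ.+ suc j′ ≡ p → j < N → ∀ i →
    p^ 2 ∣ sign i * ι (suc j′ ℕ.^ i) - ι (suc j ℕ.^ i) * (1ℚ - ι i * (π * r j))
  reflect-power j j′ eq j<N zero = ∣-resp
    (begin
      0ℚ
        ≡⟨ solve 1 (λ t → con 0ℚ := con 1ℚ :* con 1ℚ :- con 1ℚ :* (con 1ℚ :- con 0ℚ :* t)) refl (π * r j) ⟩
      1ℚ * 1ℚ - 1ℚ * (1ℚ - 0ℚ * (π * r j))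
        ≡⟨ cong₂ (λ x y → 1ℚ * x - x * (1ℚ - y * (π * r j))) (fromNat≡ι 1) (fromNat≡ι 0) ⟩
      1ℚ * ι 1 - ι 1 * (1ℚ - ι 0 * (π * r j)) ∎)
    ∣-0
  reflect-power j j′ eq j<N (suc i) = ∣-resp
    (begin
      (x - π) * (sign i * Yᵢ - Xᵢ * (1ℚ - ι i * (π * ρ))) + π * (π * (Xᵢ * (ι i * ρ)))
        ≡⟨ solve 7 (λ x π s y z i ρ → (x :- π) :* (s :* y :- z :* (con 1ℚ :- i :* (π :* ρ))) :+ π :* (π :* (z :* (i :* ρ)))
             := s :* ((x :- π) :* y) :- z :* (x :- con 1ℚ :* π :- i :* π :* (x :* ρ))) refl x π (sign i) Yᵢ Xᵢ (ι i) ρ ⟩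
      sign i * ((x - π) * Yᵢ) - Xᵢ * (x - 1ℚ * π - ι i * π * (x * ρ))
        ≡⟨ cong₂ (λ u v → sign i * ((x - π) * Yᵢ) - Xᵢ * (x - u * π - ι i * π * v)) (sym (ι*r j)) refl ⟩
      sign i * ((x - π) * Yᵢ) - Xᵢ * (x - x * ρ * π - ι i * π * (x * ρ))
        ≡⟨ cong (λ z → sign i * ((x - z) * Yᵢ) - Xᵢ * (x - x * ρ * π - ι i * π * (x * ρ))) (trans (cong ι (sym eq)) (ι-+ (suc j) (suc j′))) ⟩
      sign i * ((x - (x + y)) * Yᵢ) - Xᵢ * (x - x * ρ * π - ι i * π * (x * ρ))
        ≡⟨ solve 8 (λ x π s y z i ρ y′ → s :* ((x :- (x :+ y′)) :* y) :- z :* (x :- x :* ρ :* π :- i :* π :* (x :* ρ))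
             := (:- s) :* (y′ :* y) :- x :* z :* (con 1ℚ :- (con 1ℚ :+ i) :* (π :* ρ))) refl x π (sign i) Yᵢ Xᵢ (ι i) ρ y ⟩
      - sign i * (y * Yᵢ) - x * Xᵢ * (1ℚ - (1ℚ + ι i) * (π * ρ))
        ≡⟨ cong₂ _-_ (cong (- sign i *_) (ι-* (suc j′) (suc j′ ℕ.^ i)))
             (cong₂ (λ u v → u * (1ℚ - v * (π * ρ))) (ι-* (suc j) (suc j ℕ.^ i)) (ι-suc i)) ⟨
      - sign i * ι (suc j′ ℕ.^ suc i) - ι (suc j ℕ.^ suc i) * (1ℚ - ι (suc i) * (π * ρ)) ∎)
    (∣-+ (∣-* (∣-- (∣-ι (suc j)) (∣-ι p)) (reflect-power j j′ eq j<N i))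
         (∣-* ∣-π (∣-* ∣-π (∣-* (∣-ι _) (∣-* (∣-ι i) (∣-r (s≤s j<N)))))))
    where
    x  = ι (suc j)
    y  = ι (suc j′)
    ρ  = r j
    Xᵢ = ι (suc j ℕ.^ i)
    Yᵢ = ι (suc j′ ℕ.^ i)

  reflect-F : ∀ j j′ → suc j ℕ.+ suc j′ ≡ p → j < N → p^ 2 ∣ F j′ - F j * (1ℚ - ι e * (π * r j))
  reflect-F j j′ eq j<N = ∣-resp
    (cong (_- F j * (1ℚ - ι e * (π * r j))) (trans (cong (_* F j′) (sign-even m)) (ℚₚ.*-identityˡ (F j′))))
    (reflect-power j j′ eq j<N e)

  Q : ℚ
  Q = Σ< N F

  -- Pairing x ≤ n with p - x, where (p-x)^e ≡ x^e - e p x^(e-1); `Y` is the sum of the x^(e-1).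
  Q-by-halves : p^ 2 ∣ Q - (2ℚ * X - ι e * (π * Y))
  Q-by-halves = ∣-resp
    (begin
      Σ< n (λ k → F (N ∸ suc k) - F k * (1ℚ - ι e * (π * r k)))
        ≡⟨ Σ-cong n (λ k → solve 5 (λ g f e π r → g :- f :* (con 1ℚ :- e :* (π :* r)) := (f :+ g) :- (con 2ℚ :* f :- e :* π :* (f :* r)))
             refl (F (N ∸ suc k)) (F k) (ι e) π (r k)) ⟩
      Σ< n (λ k → (F k + F (N ∸ suc k)) - (2ℚ * F k - ι e * π * (F k * r k)))
        ≡⟨ trans (Σ-- n _ _) (cong₂ _-_ (sym (Σ-fold n F)) (trans (Σ-- n _ _) (cong₂ _-_ (Σ-*ˡ n 2ℚ F) (Σ-*ˡ n (ι e * π) _)))) ⟩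
      Q - (2ℚ * X - ι e * π * Y)
        ≡⟨ cong (λ z → Q - (2ℚ * X - z)) (ℚₚ.*-assoc (ι e) π Y) ⟩
      Q - (2ℚ * X - ι e * (π * Y)) ∎)
    (∣-Σ n λ k k<n → reflect-F k (N ∸ suc k) (indices k (<n⇒<N k<n)) (<n⇒<N k<n))
    where
    indices : ∀ k → k < N → suc k ℕ.+ suc (N ∸ suc k) ≡ p
    indices k k<N = trans (ℕₚ.+-suc (suc k) (N ∸ suc k)) (cong suc (ℕₚ.m+[n∸m]≡n k<N))

  w : ℚ
  w = ι (2 ℕ.^ e)

  F-double : ∀ k → F (suc (k ℕ.+ k)) ≡ w * F k
  F-double k = begin
    ι (suc (suc (k ℕ.+ k)) ℕ.^ e)
      ≡⟨ cong (λ l → ι (l ℕ.^ e)) (trans (cong suc (sym (ℕₚ.+-suc k k))) (cong (suc k ℕ.+_) (sym (ℕₚ.+-identityʳ (suc k))))) ⟩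
    ι ((2 ℕ.* suc k) ℕ.^ e)
      ≡⟨ ι-^-* 2 (suc k) e ⟩
    w * F k ∎

  -- The odd integers below p are the p - 2x with x ≤ n, so `Q` is the sum of (2x)^e + (p-2x)^e ≡ 2
  -- (2x)^e - e p (2x)^(e-1). Doubling turns 2 (2x)^(e-1) into `w` x^(e-1), so that no power 2^(e-1)
  -- is required.
  Q-by-parity : p^ 2 ∣ 2ℚ * Q - w * (4ℚ * X - ι e * (π * Y))
  Q-by-parity = ∣-resp
    (begin
      2ℚ * Σ< n (λ k → F (d k ℕ.+ d k) - F (suc (k ℕ.+ k)) * (1ℚ - ι e * (π * r (suc (k ℕ.+ k)))))
        ≡⟨ Σ-*ˡ n 2ℚ _ ⟨
      Σ< n (λ k → 2ℚ * (F (d k ℕ.+ d k) - F (suc (k ℕ.+ k)) * (1ℚ - ι e * (π * r (suc (k ℕ.+ k))))))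
        ≡⟨ Σ-cong n (λ k → trans
             (solve 5 (λ g f e π r → con 2ℚ :* (g :- f :* (con 1ℚ :- e :* (π :* r))) := con 2ℚ :* (g :+ f) :- f :* (con 4ℚ :- e :* (π :* (con 2ℚ :* r))))
               refl (F (d k ℕ.+ d k)) (F (suc (k ℕ.+ k))) (ι e) π (r (suc (k ℕ.+ k))))
             (trans (cong₂ (λ x y → 2ℚ * (F (d k ℕ.+ d k) + F (suc (k ℕ.+ k))) - x * (4ℚ - ι e * (π * y))) (F-double k) (sym (r-double k)))
               (solve 6 (λ g w f e π r → g :- w :* f :* (con 4ℚ :- e :* (π :* r)) := g :- (w :* con 4ℚ :* f :- w :* e :* π :* (f :* r)))
                 refl (2ℚ * (F (d k ℕ.+ d k) + F (suc (k ℕ.+ k)))) w (F k) (ι e) π (r k)))) ⟩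
      Σ< n (λ k → 2ℚ * (F (d k ℕ.+ d k) + F (suc (k ℕ.+ k))) - (w * 4ℚ * F k - w * ι e * π * (F k * r k)))
        ≡⟨ trans (Σ-- n _ _) (cong₂ _-_ (trans (Σ-*ˡ n 2ℚ _) (cong (2ℚ *_) (sym parity)))
             (trans (Σ-- n _ _) (cong₂ _-_ (Σ-*ˡ n (w * 4ℚ) F) (Σ-*ˡ n (w * ι e * π) _)))) ⟩
      2ℚ * Q - (w * 4ℚ * X - w * ι e * π * Y)
        ≡⟨ solve 6 (λ q w x e π y → q :- (w :* con 4ℚ :* x :- w :* e :* π :* y) := q :- w :* (con 4ℚ :* x :- e :* (π :* y))) refl (2ℚ * Q) w X (ι e) π Y ⟩
      2ℚ * Q - w * (4ℚ * X - ι e * (π * Y)) ∎)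
    (∣-* (∣-const (ℤ.+ 2)) (∣-Σ n λ k k<n → reflect-F (suc (k ℕ.+ k)) (d k ℕ.+ d k) (indices k k<n) (2k+1<N k k<n)))
    where
    -- The index `d k + d k` stands for the odd integer p - 2(k+1).
    d : ℕ → ℕ
    d k = n ∸ suc k

    parity : Q ≡ Σ< n (λ k → F (d k ℕ.+ d k) + F (suc (k ℕ.+ k)))
    parity = begin
      Q
        ≡⟨ Σ-parity n F ⟩
      Σ< n (λ k → F (k ℕ.+ k) + F (suc (k ℕ.+ k)))
        ≡⟨ Σ-+ n _ _ ⟩
      Σ< n (λ k → F (k ℕ.+ k)) + Σ< n (λ k → F (suc (k ℕ.+ k)))
        ≡⟨ cong (_+ Σ< n (λ k → F (suc (k ℕ.+ k)))) (Σ-reverse n _) ⟩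
      Σ< n (λ k → F (d k ℕ.+ d k)) + Σ< n (λ k → F (suc (k ℕ.+ k)))
        ≡⟨ Σ-+ n _ _ ⟨
      Σ< n (λ k → F (d k ℕ.+ d k) + F (suc (k ℕ.+ k))) ∎

    indices : ∀ k → k < n → suc (suc (k ℕ.+ k)) ℕ.+ suc (d k ℕ.+ d k) ≡ p
    indices k k<n = begin
      suc (suc (k ℕ.+ k)) ℕ.+ suc (d k ℕ.+ d k)
        ≡⟨ ℕ-Solver.solve 2 (λ k d → (ℕ-Solver.con 2 ℕ-Solver.:+ (k ℕ-Solver.:+ k)) ℕ-Solver.:+ (ℕ-Solver.con 1 ℕ-Solver.:+ (d ℕ-Solver.:+ d))
             ℕ-Solver.:= ℕ-Solver.con 1 ℕ-Solver.:+ ((ℕ-Solver.con 1 ℕ-Solver.:+ k ℕ-Solver.:+ d) ℕ-Solver.:+ (ℕ-Solver.con 1 ℕ-Solver.:+ k ℕ-Solver.:+ d))) refl k (d k) ⟩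
      suc ((suc k ℕ.+ d k) ℕ.+ (suc k ℕ.+ d k))
        ≡⟨ cong (λ l → suc (l ℕ.+ l)) (ℕₚ.m+[n∸m]≡n k<n) ⟩
      p ∎

    2k+1<N : ∀ k → k < n → suc (k ℕ.+ k) < N
    2k+1<N k k<n = subst (_≤ N) (cong suc (ℕₚ.+-suc k k)) (ℕₚ.+-mono-≤ k<n k<n)

  -- For e > 0 the term 0^e is zero; at p = 3 it is 1 and the two sums differ.
  S≡Q : 0 < m → S e ≡ Q
  S≡Q (s≤s {n = m′} z≤n) = trans (Σ-head N _) (trans (cong (_+ Q) (sym (fromNat≡ι 0))) (ℚₚ.+-identityˡ Q))

  4w≡1 : p^ 1 ∣ 4ℚ * w - 1ℚ
  4w≡1 = ∣-resp (cong (_- 1ℚ) (trans (cong (λ l → ι (2 ℕ.^ l)) N≡2+e)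
      (trans (cong ι (ℕₚ.^-distribˡ-+-* 2 2 e)) (trans (ι-* 4 (2 ℕ.^ e)) (cong (_* w) (sym (fromNat≡ι 4)))))))
    (fermat-unit 1 (ℕₚ.≤-pred 2<p))

  Y≡h₃ : p^ 1 ∣ Y - h₃ n
  Y≡h₃ = ∣-resp
    (trans (Σ-cong n λ k → solve 2 (λ f r → (f :- r :* r) :* r := f :* r :- r :* (r :* r)) refl (F k) (r k)) (Σ-- n _ _))
    (∣-Σ n λ k k<n → ∣-* (F≡r² k (<n⇒<N k<n)) (r-integral k k<n))

  π≡3+e : π ≡ 3ℚ + ι e
  π≡3+e = trans (cong (ι ∘ suc) N≡2+e) (trans (ι-+ 3 e) (cong (_+ ι e) (sym (fromNat≡ι 3))))

  3<p : 0 < m → 3 < p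
  3<p 0<m = subst (λ k → 3 < suc k) (sym N≡2+e) (s≤s (s≤s (s≤s (ℕₚ.m≤n⇒m≤n+o m 0<m))))

  -- Subtracting 2w times `Q-by-halves` from `Q-by-parity` eliminates `X` and leaves 2(1-w) Q ≡ w e
  -- p Y (mod p²). Inserting Q ≡ p B and cancelling p gives `T` ≡ 0; with 4w ≡ 1 and e ≡ -3, four
  -- times this reads 3(2B + Y) ≡ 0, and 3 is a unit for p > 3.
  h₃≡-2B : 0 < m → p^ 1 ∣ 2ℚ * B e + h₃ n
  h₃≡-2B 0<m = ∣-resp (solve 3 (λ b y h → con 2ℚ :* b :+ y :- (y :- h) := con 2ℚ :* b :+ h) refl (B e) Y (h₃ n))
    (∣-- (∣-cancel-unit 3 (<⇒∤ (3<p 0<m)) (∣-resp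
      (begin
        4ℚ * T + (4ℚ * w - 1ℚ) * (2ℚ * B e + ι e * Y) + π * Y
          ≡⟨ cong (λ z → 4ℚ * T + (4ℚ * w - 1ℚ) * (2ℚ * B e + ι e * Y) + z * Y) π≡3+e ⟩
        4ℚ * T + (4ℚ * w - 1ℚ) * (2ℚ * B e + ι e * Y) + (3ℚ + ι e) * Y
          ≡⟨ solve 4 (λ b w e y → con 4ℚ :* (con 2ℚ :* (b :- w :* b) :- w :* (e :* y)) :+ (con 4ℚ :* w :- con 1ℚ) :* (con 2ℚ :* b :+ e :* y) :+ (con 3ℚ :+ e) :* y
               := con 3ℚ :* (con 2ℚ :* b :+ y)) refl (B e) w (ι e) Y ⟩
        3ℚ * (2ℚ * B e + Y)
          ≡⟨ cong (_* (2ℚ * B e + Y)) (fromNat≡ι 3) ⟩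
        ι 3 * (2ℚ * B e + Y) ∎)
      (∣-+ (∣-+ (∣-* (∣-const (ℤ.+ 4)) p∣T)
                (∣-* 4w≡1 (∣-+ (∣-* (∣-const (ℤ.+ 2)) (B-integral e e<N)) (∣-* (∣-ι e) Y-integral))))
           (∣-* ∣-π Y-integral))))
      Y≡h₃)
    where
    T = 2ℚ * (B e - w * B e) - w * (ι e * Y)

    Y-integral : p^ 0 ∣ Y
    Y-integral = ∣-Σ n λ k k<n → ∣-* (∣-ι _) (r-integral k k<n)

    p∣T : p^ 1 ∣ T
    p∣T = ∣-cancel-π (∣-resp
      (begin
        (2ℚ * Q - w * (4ℚ * X - ι e * (π * Y))) - 2ℚ * w * (Q - (2ℚ * X - ι e * (π * Y))) - 2ℚ * (1ℚ - w) * (S e - π * B e)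
          ≡⟨ cong (λ z → (2ℚ * Q - w * (4ℚ * X - ι e * (π * Y))) - 2ℚ * w * (Q - (2ℚ * X - ι e * (π * Y))) - 2ℚ * (1ℚ - w) * (z - π * B e)) (S≡Q 0<m) ⟩
        (2ℚ * Q - w * (4ℚ * X - ι e * (π * Y))) - 2ℚ * w * (Q - (2ℚ * X - ι e * (π * Y))) - 2ℚ * (1ℚ - w) * (Q - π * B e)
          ≡⟨ solve 7 (λ q w x e π y b → (con 2ℚ :* q :- w :* (con 4ℚ :* x :- e :* (π :* y))) :- con 2ℚ :* w :* (q :- (con 2ℚ :* x :- e :* (π :* y))) :- con 2ℚ :* (con 1ℚ :- w) :* (q :- π :* b)
               := π :* (con 2ℚ :* (b :- w :* b) :- w :* (e :* y))) refl Q w X (ι e) π Y (B e) ⟩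
        π * T ∎)
      (∣-- (∣-- Q-by-parity (∣-* (∣-* (∣-const (ℤ.+ 2)) (∣-ι _)) Q-by-halves))
           (∣-* (∣-* (∣-const (ℤ.+ 2)) (∣-- ∣-1 (∣-ι _))) (S≡πB e e<N))))

  p∣2B+h₃ : p^ 1 ∣ 2ℚ * B e + h₃ n
  p∣2B+h₃ with ℕₚ.m≤n⇒m<n∨m≡n {0} {m} z≤n
  ... | inj₁ 0<m  = h₃≡-2B 0<m
  -- For p = 3 both B_0 and H_1^(3) are 1, and 2 + 1 is p.
  ... | inj₂ 0≡m = ∣-resp
    (begin
      π
        ≡⟨ π≡3+e ⟩
      3ℚ + ι e
        ≡⟨ cong (λ l → 3ℚ + ι (l ℕ.+ l)) 0≡m ⟨
      3ℚ + ι 0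
        ≡⟨ cong (λ z → 3ℚ + z) (fromNat≡ι 0) ⟨
      2ℚ * 1ℚ + (0ℚ + 1ℚ * (1ℚ * 1ℚ))
        ≡⟨ cong₂ (λ x y → 2ℚ * x + (0ℚ + y * (y * y))) (trans (sym bernoulli-zero) (bernoulli≡B 0)) (1/suc≡r 0) ⟩
      2ℚ * B 0 + (0ℚ + r 0 * (r 0 * r 0))
        ≡⟨ cong (λ z → 2ℚ * B 0 + z) (trans (Σ-last 0 _) (cong (_+ r 0 * (r 0 * r 0)) (Σ-zero _))) ⟨
      2ℚ * B 0 + h₃ 1
        ≡⟨ cong (λ l → 2ℚ * B (l ℕ.+ l) + h₃ (suc l)) 0≡m ⟩
      2ℚ * B e + h₃ n ∎)
    ∣-π

  -- The congruences combine to B ≡ W ≡ 2A - H_n^(3) ≡ 2A + 2B, so the difference -A is B/2 modulo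
  -- p.
  p∣∑a*h₂/k : p^ 1 ∣ Σ< n (λ k → a (suc k) * h₂/k (suc k)) - B e * ½
  p∣∑a*h₂/k = ∣-resp
    (begin
      (s - Δ n h₂/k) - (A + B e * ½)
        ≡⟨ cong (λ z → (s - z) - (A + B e * ½)) (Δ-h₂/k n) ⟩
      (s - (- A)) - (A + B e * ½)
        ≡⟨ solve 3 (λ s a b → (s :- (:- a)) :- (a :+ b) := s :- b) refl s A (B e * ½) ⟩
      s - B e * ½ ∎)
    (∣-- (Σ-a≡Δ h₂/k (λ k k<n → ∣-* (r-integral k k<n) (h₂-integral (suc k) (<n⇒<N k<n))) refl)
         (cancel-2 p∤2 (∣-resp
           (solve 4 (λ b w h a → con 2ℚ :* b :+ h :- (w :- (con 2ℚ :* a :- h)) :- (b :- w) := con 2ℚ :* (a :+ b :* con ½)) refl (B e) W (h₃ n) A)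
           (∣-- (∣-- p∣2B+h₃ W≡2A-h₃) B≡W))))
    where s = Σ< n (λ k → a (suc k) * h₂/k (suc k))

  -- The sum with H_k modulo p³

  -- As 1/x² ≡ x^(p-3), this sum is congruent to `S e` ≡ p B_e, and B_e is integral.
  p∣h₂ : 0 < m → p^ 1 ∣ h₂ N
  p∣h₂ 0<m = ∣-resp
    (begin
      S e - π * B e + π * B e - Σ< N (λ k → F k - r k * r k)
        ≡⟨ cong₂ (λ x y → x - π * B e + π * B e - y) (S≡Q 0<m) (Σ-- N _ _) ⟩
      Q - π * B e + π * B e - (Q - h₂ N)
        ≡⟨ solve 3 (λ q b h → q :- b :+ b :- (q :- h) := h) refl Q (π * B e) (h₂ N) ⟩
      h₂ N ∎)
    (∣-- (∣-+ (∣-weaken (S≡πB e e<N)) (∣-* ∣-π (B-integral e e<N))) (∣-Σ N F≡r²))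

  -- The counterpart of `c-sign`: the coefficient is the product of 1 + p/j over j ≤ k.
  c-shift : ∀ k → k ≤ N → p^ 2 ∣ c (p ℕ.+ k) k - (1ℚ + π * h k)
  c-shift zero    _   = ∣-resp
    (sym (trans (cong₂ (λ x y → x - (1ℚ + π * y)) (c-zero (p ℕ.+ 0)) h-zero)
      (solve 1 (λ x → con 1ℚ :- (con 1ℚ :+ x :* con 0ℚ) := con 0ℚ) refl π)))
    ∣-0
  c-shift (suc k) k<N = ∣-resp
    (begin
      (1ℚ + π * r k) * (c (p ℕ.+ k) k - (1ℚ + π * h k)) + π * (π * (r k * h k))
        ≡⟨ solve 4 (λ π r c h → (con 1ℚ :+ π :* r) :* (c :- (con 1ℚ :+ π :* h)) :+ π :* (π :* (r :* h))
             := (con 1ℚ :+ π :* r) :* c :- (con 1ℚ :+ π :* (h :+ r))) refl π (r k) (c (p ℕ.+ k) k) (h k) ⟩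
      (1ℚ + π * r k) * c (p ℕ.+ k) k - (1ℚ + π * (h k + r k))
        ≡⟨ cong₂ (λ x y → x - (1ℚ + π * y)) (c-shift-suc p k) (h-suc k) ⟨
      c (p ℕ.+ suc k) (suc k) - (1ℚ + π * h (suc k)) ∎)
    (∣-+ (∣-* (∣-+ ∣-1 (∣-* (∣-ι p) r-int)) (c-shift k k≤N))
         (∣-* ∣-π (∣-* ∣-π (∣-* r-int (h-integral k k≤N)))))
    where
    k≤N = ℕₚ.<⇒≤ k<N
    r-int = ∣-r (s≤s k<N)

  cancel-4^ : ∀ i {f x} → p^ f ∣ ι (4 ℕ.^ i) * x → p^ f ∣ x
  cancel-4^ zero    {x = x} d = ∣-resp (trans (cong (_* x) (sym (fromNat≡ι 1))) (ℚₚ.*-identityˡ x)) d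
  cancel-4^ (suc i) {x = x} d = cancel-4^ i (cancel-2 p∤2 (cancel-2 p∤2 (∣-resp
    (begin
      ι (4 ℕ.^ suc i) * x           ≡⟨ cong (_* x) (trans (ι-* 4 (4 ℕ.^ i)) (cong (_* ι (4 ℕ.^ i)) (sym (fromNat≡ι 4)))) ⟩
      4ℚ * ι (4 ℕ.^ i) * x          ≡⟨ solve 2 (λ u x → con 4ℚ :* u :* x := con 2ℚ :* (con 2ℚ :* (u :* x))) refl (ι (4 ℕ.^ i)) x ⟩
      2ℚ * (2ℚ * (ι (4 ℕ.^ i) * x)) ∎)
    d)))

  -- With D = C(2p-1, p-1) ≡ 1 (mod p²), `G N` is p D/(1 + p q)² ≡ p (1 - 2 p q). Multiplication by
  -- the unit 4^N clears the denominator.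
  G≡ : p^ 3 ∣ G N - π + 2ℚ * (π * π) * q
  G≡ = cancel-4^ N (∣-resp
    (begin
      -- For t = p q, (1+t)²(2t-1) = -1 + 3t² + 2t³; the last two terms, times p, are the multiple
      -- of p³ displayed here.
      π * (D - 1ℚ) + π * (π * (π * (3ℚ * (q * q) + 2ℚ * (π * (q * (q * q))))))
        ≡⟨ solve 3 (λ π d q → π :* (d :- con 1ℚ) :+ π :* (π :* (π :* (con 3ℚ :* (q :* q) :+ con 2ℚ :* (π :* (q :* (q :* q))))))
             := π :* d :+ (con 1ℚ :+ π :* q) :* (con 1ℚ :+ π :* q) :* (con 2ℚ :* (π :* π) :* q :- π)) refl π D q ⟩
      π * D + (1ℚ + π * q) * (1ℚ + π * q) * Z
        ≡⟨ cong₂ (λ x y → x + y * Z) (sym (ι4^*G N)) (sym 4^N) ⟩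
      ι (4 ℕ.^ N) * G N + ι (4 ℕ.^ N) * Z
        ≡⟨ solve 4 (λ u g x π → u :* g :+ u :* (x :- π) := u :* (g :- π :+ x)) refl (ι (4 ℕ.^ N)) (G N) (2ℚ * (π * π) * q) π ⟩
      ι (4 ℕ.^ N) * (G N - π + 2ℚ * (π * π) * q) ∎)
    (∣-+ (∣-* ∣-π p²∣D-1)
         (∣-* ∣-π (∣-* ∣-π (∣-* ∣-π (∣-+ (∣-* (∣-const (ℤ.+ 3)) (∣-* q-integral q-integral))
                                         (∣-* (∣-const (ℤ.+ 2)) (∣-* (∣-ι p) (∣-* q-integral (∣-* q-integral q-integral))))))))))
    where
    D = c (p ℕ.+ N) N
    Z = 2ℚ * (π * π) * q - π

    p²∣D-1 : p^ 2 ∣ D - 1ℚ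
    p²∣D-1 = ∣-resp (solve 2 (λ d x → d :- (con 1ℚ :+ x) :+ x := d :- con 1ℚ) refl D (π * h N))
      (∣-+ (c-shift N ℕₚ.≤-refl) (∣-* ∣-π (p∣h p∤2)))

    4^N : ι (4 ℕ.^ N) ≡ (1ℚ + π * q) * (1ℚ + π * q)
    4^N = trans (ι-^-* 2 2 N) (cong (λ z → z * z)
      (sym (trans (cong (λ z → 1ℚ + z) π*q) (solve 1 (λ x → con 1ℚ :+ (x :- con 1ℚ) := x) refl (ι (2 ℕ.^ N))))))

  rhs : ℚ
  rhs = 2ℚ - 2ℚ * π + 4ℚ * (π * π) * q

  -- In `G N * h N` one factor p comes from `G N` and two from `h N`; only 2 - 2 `G N` remains, and
  -- `G≡` evaluates it.
  p³∣∑a*h : 0 < m → p^ 3 ∣ Σ< N (λ k → a (suc k) * h (suc k)) - rhs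
  p³∣∑a*h 0<m = ∣-resp
    (begin
      G N * h N - 2ℚ * (G N - π + 2ℚ * (π * π) * q)
        ≡⟨ solve 4 (λ g h π q → g :* h :- con 2ℚ :* (g :- π :+ con 2ℚ :* (π :* π) :* q)
             := g :* (h :- con 2ℚ) :+ con 2ℚ :- (con 2ℚ :- con 2ℚ :* π :+ con 4ℚ :* (π :* π) :* q)) refl (G N) (h N) π q ⟩
      G N * (h N - 2ℚ) + 2ℚ - rhs
        ≡⟨ cong (_- rhs) (Σ-a*h N) ⟨
      Σ< N (λ k → a (suc k) * h (suc k)) - rhs ∎)
    (∣-- (∣-* p∣G (p²∣h p∤2 (p∣h₂ 0<m))) (∣-* (∣-const (ℤ.+ 2)) G≡))
    where
    p∣G : p^ 1 ∣ G N
    p∣G = cancel-4^ N (∣-resp (sym (ι4^*G N)) (∣-* ∣-π (c-integral (p ℕ.+ N) N)))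

  -- Passage to the congruences of the statement

  -- Integrality of x, which the congruence demands, follows from x = (x - y) + y.
  ∣⇒≡[mod] : ∀ f x y → p^ f ∣ x - y → p^ 0 ∣ y → x ≡ y [mod p ^ f ]
  ∣⇒≡[mod] f x y (multiple {d} id eq) iy =
    subst (Integral p) (solve 2 (λ x y → x :- y :+ y := x) refl x y)
      (integral-+ {x - y} {y} (subst (Integral p) (sym eq) (integral-* {ι (p ℕ.^ f)} {d} (∣⇒integral (∣-ι (p ℕ.^ f))) id)) (∣⇒integral iy)) ,
    ∣⇒integral iy , d , id , trans eq (cong (_* d) (sym (fromNat≡ι (p ℕ.^ f))))

  ∑a*H-congruence : 3 < p → ∑[1≤ k ≤ N ] centralBinom/4^ k * H k ⟨ 1 ⟩
    ≡ fromNat 2 - fromNat 2 * fromNat p + fromNat 4 * fromNat (p ℕ.^ 2) * q [mod p ^ 3 ]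
  ∑a*H-congruence 3<p = subst₂ (λ x y → x ≡ y [mod p ^ 3 ])
    (sym (trans (∑₁≡Σ< N (λ k → centralBinom/4^ k * H k ⟨ 1 ⟩)) (Σ-cong N λ k → cong₂ _*_ (a≡ (suc k)) (H⟨1⟩≡h (suc k)))))
    (cong₂ (λ x y → 2ℚ - 2ℚ * x + 4ℚ * y * q) (sym (fromNat≡ι p))
      (sym (trans (fromNat≡ι (p ℕ.^ 2)) (trans (ι-* p _) (cong (λ l → π * ι l) (ℕₚ.^-identityʳ p))))))
    (∣⇒≡[mod] 3 (Σ< N (λ k → a (suc k) * h (suc k))) rhs (p³∣∑a*h (0<m m 3<p))
      (∣-+ (∣-- (∣-const (ℤ.+ 2)) (∣-* (∣-const (ℤ.+ 2)) (∣-ι p)))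
           (∣-* (∣-* (∣-const (ℤ.+ 4)) (∣-* (∣-ι p) (∣-ι p))) q-integral)))
    where
    0<m : ∀ m → 3 < suc (suc m ℕ.+ suc m) → 0 < m
    0<m zero    (s≤s (s≤s (s≤s ())))
    0<m (suc m) _ = s≤s z≤n

  ∑a*H₂-congruence : ∑[0≤ k ≤ n ] centralBinom/4^ k * H k ⟨ 2 ⟩ ≡ - (fromNat 4 * q) [mod p ^ 1 ]
  ∑a*H₂-congruence = subst (λ x → x ≡ - (4ℚ * q) [mod p ^ 1 ])
    (sym (trans (∑₀≡Σ< n (λ k → centralBinom/4^ k * H k ⟨ 2 ⟩)) (Σ-cong (suc n) λ k → cong₂ _*_ (a≡ k) (H⟨2⟩≡h₂ k))))
    (∣⇒≡[mod] 1 (Σ< (suc n) (λ k → a k * h₂ k)) (- (4ℚ * q)) p∣∑a*h₂ (∣-neg (∣-* (∣-const (ℤ.+ 4)) q-integral)))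

  ∑a/k*H₂-congruence : ∑[1≤ k ≤ n ] centralBinom/k4^ k * H k ⟨ 2 ⟩ ≡ bernoulli e * ½ [mod p ^ 1 ]
  ∑a/k*H₂-congruence = subst₂ (λ x y → x ≡ y [mod p ^ 1 ])
    (sym (trans (∑₁≡Σ< n (λ k → centralBinom/k4^ k * H k ⟨ 2 ⟩)) (Σ-cong n λ k →
      trans (cong₂ _*_ (centralBinom/k4^≡ k) (H⟨2⟩≡h₂ (suc k))) (ℚₚ.*-assoc (a (suc k)) (r k) _))))
    (cong (_* ½) (sym (bernoulli≡B e)))
    (∣⇒≡[mod] 1 (Σ< n (λ k → a (suc k) * (r k * h₂ (suc k)))) (B e * ½) p∣∑a*h₂/k (∣-* (B-integral e e<N) ½-integral))
    where
    ½-integral : p^ 0 ∣ ½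
    ½-integral = ∣-resp (sym (1/suc≡r 1)) (∣-r 2<p)

  congruences : Congruences p N n e q
  congruences = record { congruence₁ = ∑a*H-congruence ; congruence₂ = ∑a*H₂-congruence ; congruence₃ = ∑a/k*H₂-congruence }

odd : ∀ p → ¬ (2 ∣ p) → ∃[ n ] p ≡ suc (n ℕ.+ n)
odd zero          2∤p = contradiction (2 ∣0) 2∤p
odd (suc zero)    2∤p = 0 , refl
odd (suc (suc p)) 2∤p with odd p (λ 2∣p → 2∤p (∣m∣n⇒∣m+n (∣-refl {2}) 2∣p))
... | n , refl = suc n , cong (suc ∘ suc) (sym (ℕₚ.+-suc n n))

half-double : ∀ n → (n ℕ.+ n) ℕ./ 2 ≡ n
half-double n = trans (cong (ℕ._/ 2) (trans (cong (n ℕ.+_) (sym (ℕₚ.+-identityʳ n))) (ℕₚ.*-comm 2 n))) (m*n/n≡m n 2)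

odd-prime-congruences : ∀ p (pr : Prime p) → ∃[ n ] p ≡ suc (n ℕ.+ n) →
  Congruences p (p ∸ 1) ((p ∸ 1) ℕ./ 2) (p ∸ 3) (fermatQuotient p 2 {{prime⇒nonZero pr}})
odd-prime-congruences _ pr (zero  , refl) = contradiction pr ¬prime[1]
odd-prime-congruences _ pr (suc m , refl) =
  subst₂ (λ k f → Congruences p N k f q)
    -- By computation `p ∸ 3` is only `(m + suc m) ∸ 1`; moving the successor outwards makes it
    -- `m + m`.
    (sym (half-double (suc m))) (cong (_∸ 1) (sym (ℕₚ.+-suc m m))) congruences
  where
  open AtPrime (suc m ℕ.+ suc m) pr using (p)
  open AtOddPrime m pr using (N; q; congruences)

theorem1p3 : (p : ℕ) (pr : Prime p) → ¬ (2 ∣ p) →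
  let q₂ = fermatQuotient p 2 {{prime⇒nonZero pr}} in
  (3 < p →
    ∑[1≤ k ≤ p ∸ 1 ] centralBinom/4^ k * H k ⟨ 1 ⟩
      ≡ fromNat 2 - fromNat 2 * fromNat p + fromNat 4 * fromNat (p ℕ.^ 2) * q₂
      [mod p ^ 3 ])
  ×
  (∑[0≤ k ≤ (p ∸ 1) ℕ./ 2 ] centralBinom/4^ k * H k ⟨ 2 ⟩
      ≡ - (fromNat 4 * q₂)
      [mod p ^ 1 ])
  ×
  (∑[1≤ k ≤ (p ∸ 1) ℕ./ 2 ] centralBinom/k4^ k * H k ⟨ 2 ⟩
      ≡ bernoulli (p ∸ 3) * ½
      [mod p ^ 1 ])
theorem1p3 p pr 2∤p = congruence₁ congruences , congruence₂ congruences , congruence₃ congruences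
  where congruences = odd-prime-congruences p pr (odd p 2∤p)
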